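{- Let $n\ge 2$ and $k\ge 0$. The number of Boolean intervals of rank $k$ in the right weak order of the Coxeter group of type $D_n$ is $$2^{n-k-1}\,n!\left(\binom{n-k}{k-2}+\binom{n-k-1}{k-1}+\binom{n-k}{k}\right).$$
   Context: Type $D_n$: generators $s_1,\ldots,s_{n-2},s_{n-1},s'_{n-1}$ with $m(s_i,s_{i+1})=3$ for $1\le i\le n-2$, $m(s_{n-2},s'_{n-1})=3$, all other distinct pairs commuting; it has order $2^{n-1}n!$. Right weak order: $u\le w$ iff $\ell(w)=\ell(u)+\ell(u^{ -1}w)$. A Boolean interval of rank $k$ is an interval isomorphic to the lattice of subsets of a $k$-element set. Binomial coefficients $\binom{a}{b}$ are $0$ unless $0\le b\le a$. -}

module Defs where

open import Data.Nat using (ℕ; zero; suc; _+_; _*_; _∸_; _^_; _≤_; _≡ᵇ_)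
open import Data.Nat.Combinatorics using (_C_)
open import Data.Integer using (ℤ; +_; -[1+_])
open import Data.Bool using (Bool; true; false; if_then_else_; _∨_)
open import Data.Fin using (Fin; toℕ)
open import Data.Fin.Subset using (Subset; _⊆_)
open import Data.List using (List; []; _∷_; _++_; length; reverse)
open import Data.Product using (Σ; ∃; _×_; _,_)
open import Relation.Binary.PropositionalEquality using (_≡_)
open import Relation.Nullary using (¬_)
open import Function using (_⇔_)

-- The Coxeter system of type D_n (n ≥ 2), given by its presentation.
-- Generators: s i  stands for s_{i+1}  (i = 0 … n-2, i.e. s_1 … s_{n-1}),
--             s′   stands for s'_{n-1}.

data Gen (n : ℕ) : Set where
  s  : Fin (n ∸ 1) → Gen n
  s′ : Gen n

adj : ℕ → ℕ → Bool
adj a b = (suc a ≡ᵇ b) ∨ (suc b ≡ᵇ a)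

m : {n : ℕ} → Gen n → Gen n → ℕ
m     (s i) (s j) = if toℕ i ≡ᵇ toℕ j then 1 else (if adj (toℕ i) (toℕ j) then 3 else 2)
m {n} (s i) s′    = if toℕ i + 3 ≡ᵇ n then 3 else 2    -- s_{n-2} has index n-3
m {n} s′    (s j) = if toℕ j + 3 ≡ᵇ n then 3 else 2
m     s′    s′    = 1

Word : ℕ → Set
Word n = List (Gen n)

alt : {n : ℕ} → Gen n → Gen n → ℕ → Word n
alt a b zero    = []
alt a b (suc k) = a ∷ b ∷ alt a b k

-- The congruence on words generated by the Coxeter relations (st)^{m(s,t)} = 1.
-- Elements of the Coxeter group W(D_n) are the words modulo this relation.
data _≈_ {n : ℕ} : Word n → Word n → Set where
  coxeter : ∀ a b → alt a b (m a b) ≈ []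
  ctx     : ∀ u v x y → x ≈ y → (u ++ x ++ v) ≈ (u ++ y ++ v)
  ≈-refl  : ∀ x → x ≈ x
  ≈-sym   : ∀ {x y} → x ≈ y → y ≈ x
  ≈-trans : ∀ {x y z} → x ≈ y → y ≈ z → x ≈ z

-- Inverse of a group element represented by a word (generators are involutions).
inv : {n : ℕ} → Word n → Word n
inv = reverse

Length : {n : ℕ} → Word n → ℕ → Set
Length {n} w l = (Σ (Word n) λ v → (v ≈ w) × (length v ≡ l))
               × (∀ (v : Word n) → v ≈ w → l ≤ length v)

_≤R_ : {n : ℕ} → Word n → Word n → Set
u ≤R w = ∃ λ a → ∃ λ b → ∃ λ c →
  Length u a × Length w b × Length (inv u ++ w) c × (b ≡ a + c)

InInterval : {n : ℕ} → Word n → Word n → Word n → Set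
InInterval u w v = (u ≤R v) × (v ≤R w)

Interval : {n : ℕ} → Word n → Word n → Set
Interval {n} u w = Σ (Word n) (InInterval u w)

IsBooleanOfRank : {n : ℕ} → ℕ → Word n → Word n → Set
IsBooleanOfRank {n} k u w =
  Σ (Interval u w → Subset k) λ f →
  Σ (Subset k → Interval u w) λ g →
    (∀ (x : Interval u w) → Σ.proj₁ (g (f x)) ≈ Σ.proj₁ x)
  × (∀ (S : Subset k) → f (g S) ≡ S)
  × (∀ (x y : Interval u w) → (Σ.proj₁ x ≤R Σ.proj₁ y) ⇔ (f x ⊆ f y))

-- Boolean intervals [u, w] of rank k (a pair u ≤R w; [u,w] determines u, w).
BoolInt : ℕ → ℕ → Set
BoolInt n k = Σ (Word n × Word n) λ { (u , w) → (u ≤R w) × IsBooleanOfRank k u w }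

NumBoolInt : ℕ → ℕ → ℕ → Set
NumBoolInt n k N =
  Σ (Fin N → BoolInt n k) λ e →
    (∀ i j → (Σ.proj₁ (Σ.proj₁ (e i)) ≈ Σ.proj₁ (Σ.proj₁ (e j)))
           → (Σ.proj₂ (Σ.proj₁ (e i)) ≈ Σ.proj₂ (Σ.proj₁ (e j))) → i ≡ j)
  × (∀ (b : BoolInt n k) → Σ (Fin N) λ i →
        (Σ.proj₁ (Σ.proj₁ (e i)) ≈ Σ.proj₁ (Σ.proj₁ b))
      × (Σ.proj₂ (Σ.proj₁ (e i)) ≈ Σ.proj₂ (Σ.proj₁ b)))

-- Binomial coefficient with integer arguments: 0 unless 0 ≤ b ≤ a.
binomℤ : ℤ → ℤ → ℕ
binomℤ (+ a) (+ b) = a C b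
binomℤ _     _     = 0

{-# OPTIONS --safe #-}
module Submission where

-- W(D_n) acts on ℤⁿ by permuting coordinates and changing signs in pairs. Send a word w to w·ρ with
-- ρ = (n-1, …, 1, 0). The sign of a simple root form at w·ρ decides whether a generator lengthens or shortens
-- w: this follows by induction on length from the values of the forms along braids of two generators, and it
-- yields normal forms, the length function and the faithfulness of the action on the orbit of ρ.
-- In a Boolean interval [u, w] the atoms are u t for t in a set J of ascents of u. If two elements t, r of J
-- did not commute, then u t r would lie strictly between u t and the join of u t and u r; so J is independent
-- in the Coxeter graph and w = u ∏ J. Conversely every such pair (u, J) gives a Boolean interval. For fixed J
-- the generators in J flip the signs of the corresponding forms independently, so a fraction 2^{-k} of the
-- 2^{n-1} n! elements u qualifies, and the independent k-sets obey the Pascal-type recurrence of the formula.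

open import Defs
open import Data.Bool using (Bool; true; false; if_then_else_; T)
open import Data.Bool.Properties using (∨-comm)
open import Data.Fin using (Fin; zero; suc; toℕ)
open import Data.Fin.Properties using (toℕ-injective)
open import Data.Fin.Subset using (Subset; inside; outside; _⊆_; ⁅_⁆; _∪_; ⊤; ⊥) renaming (_∈_ to _∈ₛ_)
open import Data.Fin.Subset.Properties using (out⊆; in⊆in; drop-∷-⊆; ⊆-antisym; x∈⁅x⁆; x∈⁅y⁆⇒x≡y; p⊆p∪q; q⊆p∪q; x∈p∪q⁻; ∉⊥; ∈⊤) renaming (_∈?_ to _∈ₛ?_)
open import Data.Integer as ℤ using (ℤ; +_; -[1+_]; -_; _-_; 0ℤ; ∣_∣)
import Data.Integer.Properties as ℤₚ
open import Data.Integer.Tactic.RingSolver using (solve-∀)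
open import Data.List as List using (List; []; _∷_; _++_; [_]; length; tabulate; filter; downFrom; allFin; cartesianProduct)
import Data.List.Properties as Listₚ
open import Data.List.Membership.DecPropositional using () renaming (_∈?_ to ∈?)
open import Data.List.Membership.Propositional using (_∈_; _∉_)
open import Data.List.Membership.Propositional.Properties using (∈-∃++; ∈-++⁻; ∈-++⁺ˡ; ∈-++⁺ʳ; ∈-tabulate⁺; ∈-allFin; ∈-downFrom⁻; ∈-map⁺; ∈-map⁻; ∈-filter⁺; ∈-filter⁻; ∈-cartesianProduct⁺; ∈-cartesianProduct⁻; ∈-lookup; ∈-AllPairs₂)
open import Data.List.Membership.Propositional.Properties.WithK using (unique∧set⇒bag)
open import Data.List.Relation.Binary.BagAndSetEquality using (∼bag⇒↭)
open import Data.List.Relation.Binary.Permutation.Propositional as ↭ using (_↭_; ↭⇒↭ₛ; ↭-sym; ↭-trans; ↭-refl)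
open import Data.List.Relation.Binary.Permutation.Propositional.Properties as ↭ₚ using (All-resp-↭; ↭-length; ↭-empty-inv; ↭-singleton-inv; shift; ∈-resp-↭; drop-∷; ++⁺ʳ; filter-↭)
import Data.List.Relation.Binary.Permutation.Setoid.Properties as ↭ₛ
open import Data.List.Relation.Unary.All as All using (All; []; _∷_; all?)
import Data.List.Relation.Unary.All.Properties as Allₚ
open import Data.List.Relation.Unary.AllPairs as AllPairs using (AllPairs; []; _∷_)
import Data.List.Relation.Unary.AllPairs.Properties as AllPairsₚ
open import Data.List.Relation.Unary.Any using (here; there; index)
open import Data.List.Relation.Unary.Any.Properties using (lookup-index)
open import Data.List.Relation.Unary.Unique.Propositional using (Unique)
import Data.List.Relation.Unary.Unique.Propositional.Properties as Uniqueₚ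
open import Data.Nat using (ℕ; zero; suc; _+_; _*_; _^_; _≤_; _<_; _!; _≡ᵇ_; z≤n; s≤s)
open import Data.Nat.Combinatorics using (nCk+nC[k+1]≡[n+1]C[k+1])
import Data.Nat.Properties as ℕₚ
open import Data.Nat.Tactic.RingSolver using () renaming (solve-∀ to solveℕ-∀)
open import Data.Product using (Σ; _×_; _,_; proj₁; proj₂)
open import Data.Sum using (_⊎_; inj₁; inj₂; [_,_]′)
open import Data.Unit using (tt) renaming (⊤ to Unit)
open import Data.Vec as Vec using (Vec; []; _∷_; toList; insertAt; removeAt; lookup)
import Data.Vec.Properties as Vecₚ
open import Function using (mk⇔; Equivalence; _∘_)
open import Relation.Binary.PropositionalEquality hiding ([_])
open import Relation.Nullary using (¬_; Dec; yes; no; contradiction)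
open import Relation.Unary using (Decidable)

-- The action of W(D_n) on ℤⁿ

-- The relation `≈` only ever identifies words. Every proof that two words differ, or that a word
-- cannot be shortened, therefore goes through the action, and nothing about Coxeter groups is
-- presupposed. The vector ρ is half the sum of the positive roots: each simple form takes the value
-- 1 on it, so it lies strictly inside the fundamental chamber. Its last entry 0 does no harm,
-- because signs change in pairs and a stray sign can be parked on that entry. The exchange
-- condition appears as a disjunction: a positive form, or an explicit shorter word beginning with
-- the generator. For arbitrary words the alternatives may both hold; for reduced words they exclude
-- each other, and this is what makes reduced words minimal. Weak order extends words on the right
-- while the action sees the left end, so the ascents of u are read off at the image of ρ under the
-- inverse of u. All counts are compared after multiplication by powers of 2, which avoids division
-- and truncated exponents.

act : ∀ {n} → Gen (2 + n) → Vec ℤ (2 + n) → Vec ℤ (2 + n)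
act         (s zero)    (a ∷ b ∷ p)  = b ∷ a ∷ p
act {suc n} (s (suc i)) (a ∷ p)      = a ∷ act (s i) p
act {zero}  s′          (a ∷ b ∷ []) = - b ∷ - a ∷ []
act {suc n} s′          (a ∷ p)      = a ∷ act s′ p

-- Pairing with the simple roots e_i - e_{i+1} and e_{n-1} + e_n.
form : ∀ {n} → Gen (2 + n) → Vec ℤ (2 + n) → ℤ
form         (s zero)    (a ∷ b ∷ p)  = a - b
form {suc n} (s (suc i)) (a ∷ p)      = form (s i) p
form {zero}  s′          (a ∷ b ∷ []) = a ℤ.+ b
form {suc n} s′          (a ∷ p)      = form s′ p

-- The reflection formula y - c x of a simply laced root system, with Cartan integer c = 2, 0, -1
-- for bond 1, 2, 3. For bond 1 the two generators agree, so y = x and the value is - x.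
reflect : ℕ → ℤ → ℤ → ℤ
reflect 1 x y = - x
reflect 2 x y = y
reflect _ x y = x ℤ.+ y

form-act : ∀ {n} (t r : Gen (2 + n)) p → form r (act t p) ≡ reflect (m t r) (form t p) (form r p)
form-act (s zero) (s zero) (a ∷ b ∷ p) = eq a b
  where eq : ∀ a b → b - a ≡ - (a - b)
        eq = solve-∀
form-act {suc n} (s zero) (s (suc zero)) (a ∷ b ∷ c ∷ p) = eq a b c
  where eq : ∀ a b c → a - c ≡ (a - b) ℤ.+ (b - c)
        eq = solve-∀
form-act {suc (suc n)} (s zero) (s (suc (suc j))) (a ∷ b ∷ c ∷ p) = refl
form-act {suc n} (s (suc zero)) (s zero) (a ∷ b ∷ c ∷ p) = eq a b c
  where eq : ∀ a b c → a - c ≡ (b - c) ℤ.+ (a - b)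
        eq = solve-∀
form-act {suc (suc n)} (s (suc (suc i))) (s zero) (a ∷ b ∷ c ∷ p) = refl
form-act {suc n} (s (suc i)) (s (suc j)) (a ∷ p) = form-act (s i) (s j) p
form-act {zero} (s zero) s′ (a ∷ b ∷ []) = ℤₚ.+-comm b a
form-act {suc zero} (s zero) s′ (a ∷ b ∷ c ∷ []) = eq a b c
  where eq : ∀ a b c → a ℤ.+ c ≡ (a - b) ℤ.+ (b ℤ.+ c)
        eq = solve-∀
form-act {suc (suc n)} (s zero) s′ (a ∷ b ∷ p) = refl
form-act {suc n} (s (suc i)) s′ (a ∷ p) = form-act (s i) s′ p
form-act {zero} s′ (s zero) (a ∷ b ∷ []) = eq a b
  where eq : ∀ a b → - b - - a ≡ a - b
        eq = solve-∀
form-act {suc zero} s′ (s zero) (a ∷ b ∷ c ∷ []) = eq a b c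
  where eq : ∀ a b c → a - - c ≡ (b ℤ.+ c) ℤ.+ (a - b)
        eq = solve-∀
form-act {suc (suc n)} s′ (s zero) (a ∷ b ∷ p) = refl
form-act {suc n} s′ (s (suc j)) (a ∷ p) = form-act s′ (s j) p
form-act {zero} s′ s′ (a ∷ b ∷ []) = eq a b
  where eq : ∀ a b → - b ℤ.+ - a ≡ - (a ℤ.+ b)
        eq = solve-∀
form-act {suc n} s′ s′ (a ∷ p) = form-act s′ s′ p

actW : ∀ {n} → Word (2 + n) → Vec ℤ (2 + n) → Vec ℤ (2 + n)
actW []      p = p
actW (t ∷ w) p = act t (actW w p)

actW-++ : ∀ {n} (u v : Word (2 + n)) p → actW (u ++ v) p ≡ actW u (actW v p)
actW-++ []      v p = refl
actW-++ (t ∷ u) v p = cong (act t) (actW-++ u v p)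

-- The inclusion of D_n into D_{n+1} as the parabolic subgroup omitting s_1.
↑_ : ∀ {n} → Gen (2 + n) → Gen (3 + n)
↑ s i = s (suc i)
↑ s′  = s′

act-↑ : ∀ {n} (t : Gen (2 + n)) a p → act (↑ t) (a ∷ p) ≡ a ∷ act t p
act-↑ (s i) a p = refl
act-↑ s′    a p = refl

m-↑ : ∀ {n} (t r : Gen (2 + n)) → m (↑ t) (↑ r) ≡ m t r
m-↑ (s i) (s j) = refl
m-↑ (s i) s′    = refl
m-↑ s′    (s j) = refl
m-↑ s′    s′    = refl

act-involutive : ∀ {n} (t : Gen (2 + n)) p → act t (act t p) ≡ p
act-involutive         (s zero)    (a ∷ b ∷ p)  = refl
act-involutive {suc n} (s (suc i)) (a ∷ p)      = cong (a ∷_) (act-involutive (s i) p)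
act-involutive {zero}  s′          (a ∷ b ∷ []) =
  cong₂ (λ x y → x ∷ y ∷ []) (ℤₚ.neg-involutive a) (ℤₚ.neg-involutive b)
act-involutive {suc n} s′          (a ∷ p)      = cong (a ∷_) (act-involutive s′ p)

actW-alt-↑ : ∀ {n} (t r : Gen (2 + n)) k a p →
             actW (alt (↑ t) (↑ r) k) (a ∷ p) ≡ a ∷ actW (alt t r k) p
actW-alt-↑ t r zero    a p = refl
actW-alt-↑ t r (suc k) a p
  rewrite actW-alt-↑ t r k a p | act-↑ r a (actW (alt t r k) p) = act-↑ t a _

coxeter-↑ : ∀ {n} (t r : Gen (2 + n)) a p → actW (alt t r (m t r)) p ≡ p →
            actW (alt (↑ t) (↑ r) (m t r)) (a ∷ p) ≡ a ∷ p
coxeter-↑ t r a p e = trans (actW-alt-↑ t r (m t r) a p) (cong (a ∷_) e)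

private
  neg² = ℤₚ.neg-involutive

actW-coxeter : ∀ {n} (t r : Gen (2 + n)) p → actW (alt t r (m t r)) p ≡ p
actW-coxeter (s zero) (s zero) (a ∷ b ∷ p) = refl
actW-coxeter {suc n} (s zero) (s (suc zero)) (a ∷ b ∷ c ∷ p) = refl
actW-coxeter {suc (suc n)} (s zero) (s (suc (suc j))) (a ∷ b ∷ p) =
  cong (λ q → a ∷ b ∷ q) (act-involutive (s j) p)
actW-coxeter {suc n} (s (suc zero)) (s zero) (a ∷ b ∷ c ∷ p) = refl
actW-coxeter {suc (suc n)} (s (suc (suc i))) (s zero) (a ∷ b ∷ p) =
  cong (λ q → a ∷ b ∷ q) (act-involutive (s i) p)
actW-coxeter {suc n} (s (suc i)) (s (suc j)) (a ∷ p) =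
  coxeter-↑ {n} (s i) (s j) a p (actW-coxeter (s i) (s j) p)
actW-coxeter {zero} (s zero) s′ (a ∷ b ∷ []) rewrite neg² a | neg² b = refl
actW-coxeter {suc zero} (s zero) s′ (a ∷ b ∷ c ∷ []) rewrite neg² a | neg² b | neg² c = refl
actW-coxeter {suc (suc n)} (s zero) s′ (a ∷ b ∷ p) =
  cong (λ q → a ∷ b ∷ q) (act-involutive s′ p)
actW-coxeter {suc n} (s (suc i)) s′ (a ∷ p) =
  coxeter-↑ {n} (s i) s′ a p (actW-coxeter (s i) s′ p)
actW-coxeter {zero} s′ (s zero) (a ∷ b ∷ []) rewrite neg² a | neg² b = refl
actW-coxeter {suc zero} s′ (s zero) (a ∷ b ∷ c ∷ []) rewrite neg² a | neg² b | neg² c = refl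
actW-coxeter {suc (suc n)} s′ (s zero) (a ∷ b ∷ p) =
  cong (λ q → a ∷ b ∷ q) (act-involutive s′ p)
actW-coxeter {suc n} s′ (s (suc j)) (a ∷ p) =
  coxeter-↑ {n} s′ (s j) a p (actW-coxeter s′ (s j) p)
actW-coxeter s′ s′ p = act-involutive s′ p

actW-≈ : ∀ {n} {u v : Word (2 + n)} → u ≈ v → ∀ p → actW u p ≡ actW v p
actW-≈ (coxeter t r)   p = actW-coxeter t r p
actW-≈ (ctx u v x y e) p = begin
  actW (u ++ x ++ v) p          ≡⟨ actW-++ u (x ++ v) p ⟩
  actW u (actW (x ++ v) p)      ≡⟨ cong (actW u) (actW-++ x v p) ⟩
  actW u (actW x (actW v p))    ≡⟨ cong (actW u) (actW-≈ e (actW v p)) ⟩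
  actW u (actW y (actW v p))    ≡⟨ cong (actW u) (actW-++ y v p) ⟨
  actW u (actW (y ++ v) p)      ≡⟨ actW-++ u (y ++ v) p ⟨
  actW (u ++ y ++ v) p          ∎
  where open ≡-Reasoning
actW-≈ (≈-refl _)    p = refl
actW-≈ (≈-sym e)     p = sym (actW-≈ e p)
actW-≈ (≈-trans e f) p = trans (actW-≈ e p) (actW-≈ f p)

-- Bonds of the Coxeter graph and their effect on the forms

m-self : ∀ {n} (t : Gen n) → m t t ≡ 1
m-self (s i) = go (toℕ i)
  where go : ∀ a → (if a ≡ᵇ a then 1 else (if adj a a then 3 else 2)) ≡ 1
        go zero    = refl
        go (suc a) = go a
m-self s′    = refl

≡ᵇ-comm : ∀ a b → (a ≡ᵇ b) ≡ (b ≡ᵇ a)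
≡ᵇ-comm zero    zero    = refl
≡ᵇ-comm zero    (suc b) = refl
≡ᵇ-comm (suc a) zero    = refl
≡ᵇ-comm (suc a) (suc b) = ≡ᵇ-comm a b

m-sym : ∀ {n} (t r : Gen n) → m t r ≡ m r t
m-sym (s i) (s j)
  rewrite ≡ᵇ-comm (toℕ i) (toℕ j) | ∨-comm (suc (toℕ i) ≡ᵇ toℕ j) (suc (toℕ j) ≡ᵇ toℕ i) = refl
m-sym (s i) s′    = refl
m-sym s′    (s j) = refl
m-sym s′    s′    = refl

data Bond {n} (t r : Gen n) : Set where
  same     : t ≡ r → Bond t r
  commute  : m t r ≡ 2 → Bond t r
  braid    : m t r ≡ 3 → Bond t r

bond : ∀ {n} (t r : Gen n) → Bond t r
bond (s i) (s j) with toℕ i ≡ᵇ toℕ j in eq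
... | true  = same (cong s (toℕ-injective (ℕₚ.≡ᵇ⇒≡ _ _ (subst T (sym eq) _))))
... | false with adj (toℕ i) (toℕ j) in e
...   | true  = braid (lem eq e)
  where lem : ∀ {x y} → x ≡ false → y ≡ true → (if x then 1 else (if y then 3 else 2)) ≡ 3
        lem refl refl = refl
...   | false = commute (lem eq e)
  where lem : ∀ {x y} → x ≡ false → y ≡ false → (if x then 1 else (if y then 3 else 2)) ≡ 2
        lem refl refl = refl
bond {n} (s i) s′ with toℕ i + 3 ≡ᵇ n in eq
... | true  = braid   (cong (if_then 3 else 2) eq)
... | false = commute (cong (if_then 3 else 2) eq)
bond {n} s′ (s j) with toℕ j + 3 ≡ᵇ n in eq
... | true  = braid   (cong (if_then 3 else 2) eq)
... | false = commute (cong (if_then 3 else 2) eq)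
bond s′ s′ = same refl

form-act-same : ∀ {n} (t : Gen (2 + n)) p → form t (act t p) ≡ - form t p
form-act-same t p = trans (form-act t t p) (cong (λ k → reflect k (form t p) (form t p)) (m-self t))

form-act-commute : ∀ {n} (t r : Gen (2 + n)) → m t r ≡ 2 → ∀ p → form r (act t p) ≡ form r p
form-act-commute t r e p = trans (form-act t r p) (cong (λ k → reflect k (form t p) (form r p)) e)

form-act-braid : ∀ {n} (t r : Gen (2 + n)) → m t r ≡ 3 → ∀ p →
                 form r (act t p) ≡ form t p ℤ.+ form r p
form-act-braid t r e p = trans (form-act t r p) (cong (λ k → reflect k (form t p) (form r p)) e)

-- Inside a subsystem of type A_2, two reflections carry one simple root to the other. This one
-- value drives the last braid case of `exchange′` and the contradiction in `labels-commute`.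
form-act-braid² : ∀ {n} (t r : Gen (2 + n)) → m t r ≡ 3 → ∀ p →
                  form r (act t (act r p)) ≡ form t p
form-act-braid² t r e p = begin
  form r (act t (act r p))                   ≡⟨ form-act-braid t r e (act r p) ⟩
  form t (act r p) ℤ.+ form r (act r p)      ≡⟨ cong₂ ℤ._+_ (form-act-braid r t (trans (m-sym r t) e) p) (form-act-same r p) ⟩
  (form r p ℤ.+ form t p) ℤ.+ (- form r p)   ≡⟨ cancel (form t p) (form r p) ⟩
  form t p                                   ∎
  where
  open ≡-Reasoning
  cancel : ∀ x y → (y ℤ.+ x) ℤ.+ (- y) ≡ x
  cancel = solve-∀

ρ : ∀ n → Vec ℤ n
ρ zero    = []
ρ (suc n) = + n ∷ ρ n

form-ρ : ∀ {n} (t : Gen (2 + n)) → ℤ.0ℤ ℤ.< form t (ρ (2 + n))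
form-ρ {n} (s zero) rewrite ℤₚ.m-n≡m⊖n (suc n) n | ℤₚ.⊖-≥ (ℕₚ.n≤1+n n) | ℕₚ.m+n∸n≡m 1 n = ℤ.+<+ (s≤s z≤n)
form-ρ {suc n} (s (suc i)) = form-ρ (s i)
form-ρ {zero}  s′          = ℤ.+<+ (s≤s z≤n)
form-ρ {suc n} s′          = form-ρ {n} s′

-- Normal forms and length

infixr 5 _∙_
_∙_ : ∀ {n} {x y z : Word n} → x ≈ y → y ≈ z → x ≈ z
_∙_ = ≈-trans

≈-reflexive : ∀ {n} {x y : Word n} → x ≡ y → x ≈ y
≈-reflexive refl = ≈-refl _

++-congˡ : ∀ {n} (u : Word n) {x y} → x ≈ y → (u ++ x) ≈ (u ++ y)
++-congˡ u {x} {y} e =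
  subst₂ (λ a b → (u ++ a) ≈ (u ++ b)) (Listₚ.++-identityʳ x) (Listₚ.++-identityʳ y) (ctx u [] x y e)

++-congʳ : ∀ {n} (v : Word n) {x y} → x ≈ y → (x ++ v) ≈ (y ++ v)
++-congʳ v {x} {y} = ctx [] v x y

++-cong : ∀ {n} {x y u v : Word n} → x ≈ y → u ≈ v → (x ++ u) ≈ (y ++ v)
++-cong {y = y} {u} e f = ++-congʳ u e ∙ ++-congˡ y f

∷-cong : ∀ {n} (t : Gen n) {x y} → x ≈ y → (t ∷ x) ≈ (t ∷ y)
∷-cong t = ++-congˡ [ t ]

≈-assoc : ∀ {n} (x y z : Word n) → ((x ++ y) ++ z) ≈ (x ++ (y ++ z))
≈-assoc x y z = ≈-reflexive (Listₚ.++-assoc x y z)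

∷-cancel : ∀ {n} (t : Gen n) w → (t ∷ t ∷ w) ≈ w
∷-cancel t w = ++-congʳ w (subst (λ k → alt t t k ≈ []) (m-self t) (coxeter t t))

inv-cancelˡ : ∀ {n} (w x : Word n) → (inv w ++ (w ++ x)) ≈ x
inv-cancelˡ []      x = ≈-refl x
inv-cancelˡ (t ∷ w) x =
  ≈-reflexive (trans (cong (_++ (t ∷ w ++ x)) (Listₚ.unfold-reverse t w))
                     (Listₚ.++-assoc (inv w) [ t ] (t ∷ w ++ x)))
  ∙ ++-congˡ (inv w) (∷-cancel t (w ++ x)) ∙ inv-cancelˡ w x

inv-cancelʳ : ∀ {n} (w x : Word n) → (w ++ (inv w ++ x)) ≈ x
inv-cancelʳ w x =
  subst (λ v → (v ++ (inv w ++ x)) ≈ x) (Listₚ.reverse-involutive w) (inv-cancelˡ (inv w) x)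

++-cancelˡ : ∀ {n} (u : Word n) {x y} → (u ++ x) ≈ (u ++ y) → x ≈ y
++-cancelˡ u {x} {y} e =
  ≈-sym (inv-cancelˡ u x) ∙ ++-congˡ (inv u) e ∙ inv-cancelˡ u y

∷-cancelˡ : ∀ {n} {t : Gen n} {x y} → (t ∷ x) ≈ (t ∷ y) → x ≈ y
∷-cancelˡ {t = t} = ++-cancelˡ [ t ]

inv-unique : ∀ {n} {u v : Word n} → (u ++ v) ≈ [] → inv u ≈ v
inv-unique {u = u} {v} e =
  ++-cancelˡ u (≈-reflexive (cong (u ++_) (sym (Listₚ.++-identityʳ (inv u))))
                ∙ inv-cancelʳ u [] ∙ ≈-sym e)

inv-cong : ∀ {n} {u v : Word n} → u ≈ v → inv u ≈ inv v
inv-cong {u = u} {v} e = inv-unique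
  (++-congʳ (inv v) e ∙ ≈-reflexive (cong (v ++_) (sym (Listₚ.++-identityʳ (inv v)))) ∙ inv-cancelʳ v [])

inv-++ : ∀ {n} (u v : Word n) → inv (u ++ v) ≡ inv v ++ inv u
inv-++ = Listₚ.reverse-++

commute-≈ : ∀ {n} {t r : Gen n} → m t r ≡ 2 → ∀ x → (t ∷ r ∷ x) ≈ (r ∷ t ∷ x)
commute-≈ {t = t} {r} e x = ≈-sym
  (≈-sym (++-congʳ (r ∷ t ∷ x) (subst (λ k → alt t r k ≈ []) e (coxeter t r)))
   ∙ ∷-cong t (∷-cong r (∷-cong t (∷-cancel r (t ∷ x)) ∙ ∷-cancel t x)))

braid-≈ : ∀ {n} {t r : Gen n} → m t r ≡ 3 → ∀ x → (t ∷ r ∷ t ∷ x) ≈ (r ∷ t ∷ r ∷ x)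
braid-≈ {t = t} {r} e x = ≈-sym
  (≈-sym (++-congʳ (r ∷ t ∷ r ∷ x) (subst (λ k → alt t r k ≈ []) e (coxeter t r)))
   ∙ ∷-cong t (∷-cong r (∷-cong t
       (∷-cong r (∷-cong t (∷-cancel r (t ∷ r ∷ x)) ∙ ∷-cancel t (r ∷ x)) ∙ ∷-cancel r x))))

module _ {n : ℕ} where

  W = Word (2 + n)

  point : W → Vec ℤ (2 + n)
  point w = actW w (ρ (2 + n))

  point-≈ : ∀ {u v} → u ≈ v → point u ≡ point v
  point-≈ e = actW-≈ e (ρ (2 + n))

  -- These concern multiplication on the left: t w is longer than w in an ascent. The ascents on the right
  -- of u are those of inv u.
  record Ascent (t : Gen (2 + n)) (w : W) : Set where
    constructor ascent
    field positive : 0ℤ ℤ.< form t (point w)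

  record Descent (t : Gen (2 + n)) (w : W) : Set where
    constructor descent
    field negative : form t (point w) ℤ.< 0ℤ

  Shorter : Gen (2 + n) → W → Set
  Shorter t w = Σ W λ w′ → (w ≈ (t ∷ w′)) × length w′ < length w

  private
    -- In the braid case the letters r, t, r are peeled off the front of w one at a time. If both
    -- forms are positive at v, so is their sum, the form of t at r v. If v starts with t but the
    -- rest v′ has r as an ascent, the form of t at r t v′ equals that of r at v′. If all three
    -- letters come off, a braid move brings t to the front. The bound `l` is needed because the
    -- recursion passes to shortened words that are not tails of w.
    exchange′ : ∀ l w → length w ≤ l → ∀ t → Ascent t w ⊎ Shorter t w
    exchange′ l       []      _       t = inj₁ (ascent (form-ρ t))
    exchange′ (suc l) (r ∷ v) (s≤s h) t with bond r t
    ... | same refl = inj₂ (v , ≈-refl _ , ℕₚ.≤-refl)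
    ... | commute e with exchange′ l v h t
    ...   | inj₁ (ascent a) = inj₁ (ascent (subst (0ℤ ℤ.<_) (sym (form-act-commute r t e (point v))) a))
    ...   | inj₂ (v′ , e′ , lt) = inj₂ (r ∷ v′ , ∷-cong r e′ ∙ commute-≈ e v′ , s≤s lt)
    exchange′ (suc l) (r ∷ v) (s≤s h) t | braid e with exchange′ l v h r
    ... | inj₂ (v′ , e′ , lt) with exchange′ l v′ (ℕₚ.≤-trans (ℕₚ.<⇒≤ lt) h) t
    ...   | inj₁ (ascent a) = inj₁ (ascent (subst (λ p → 0ℤ ℤ.< form t p) (sym (point-≈ rv≈v′)) a))
      where rv≈v′ = ∷-cong r e′ ∙ ∷-cancel r v′
    ...   | inj₂ (v″ , e″ , lt′) = inj₂ (v″ , ∷-cong r e′ ∙ ∷-cancel r v′ ∙ e″ , ℕₚ.m<n⇒m<1+n (ℕₚ.<-trans lt′ lt))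
    exchange′ (suc l) (r ∷ v) (s≤s h) t | braid e | inj₁ (ascent a) with exchange′ l v h t
    ... | inj₁ (ascent b) = inj₁ (ascent (subst (0ℤ ℤ.<_) (sym (form-act-braid r t e (point v))) (ℤₚ.+-mono-< a b)))
    ... | inj₂ (v′ , e′ , lt) with exchange′ l v′ (ℕₚ.≤-trans (ℕₚ.<⇒≤ lt) h) r
    ...   | inj₂ (v″ , e″ , lt′) = inj₂ (r ∷ t ∷ v″
              , ∷-cong r (e′ ∙ ∷-cong t e″) ∙ braid-≈ e v″
              , s≤s (ℕₚ.≤-trans (s≤s lt′) lt))
    ...   | inj₁ (ascent b) = inj₁ (ascent (subst (0ℤ ℤ.<_) (sym eq) b))
      where
      eq : form t (point (r ∷ v)) ≡ form r (point v′)
      eq = trans (cong (λ q → form t (act r q)) (point-≈ e′)) (form-act-braid² r t e (point v′))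

  exchange : ∀ w t → Ascent t w ⊎ Shorter t w
  exchange w = exchange′ (length w) w ℕₚ.≤-refl

  data Reduced : W → Set where
    []  : Reduced []
    _∷_ : ∀ {t w} → Ascent t w → Reduced w → Reduced (t ∷ w)

  ascent-flip : ∀ {t w} → Ascent t w → Descent t (t ∷ w)
  ascent-flip {t} {w} (ascent a) =
    descent (subst (ℤ._< 0ℤ) (sym (form-act-same t (point w))) (ℤₚ.neg-mono-< a))

  descent-flip : ∀ {t w} → Descent t w → Ascent t (t ∷ w)
  descent-flip {t} {w} (descent d) =
    ascent (subst (0ℤ ℤ.<_) (sym (form-act-same t (point w))) (ℤₚ.neg-mono-< d))

  ascent-≈ : ∀ {t u v} → u ≈ v → Ascent t u → Ascent t v
  ascent-≈ {t} e (ascent a) = ascent (subst (λ p → 0ℤ ℤ.< form t p) (point-≈ e) a)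

  descent-≈ : ∀ {t u v} → u ≈ v → Descent t u → Descent t v
  descent-≈ {t} e (descent d) = descent (subst (λ p → form t p ℤ.< 0ℤ) (point-≈ e) d)

  ascent-descent : ∀ {t w} → Ascent t w → ¬ Descent t w
  ascent-descent (ascent a) (descent d) = ℤₚ.<-asym a d

  private
    normalise′ : ∀ l w → length w ≤ l → Σ W λ r → Reduced r × (w ≈ r) × length r ≤ length w
    normalise′ l       []      _       = [] , [] , ≈-refl [] , z≤n
    normalise′ (suc l) (t ∷ v) (s≤s h) with normalise′ l v h
    ... | r , red , e , r≤v with exchange r t
    ...   | inj₁ a = t ∷ r , a ∷ red , ∷-cong t e , s≤s r≤v
    ...   | inj₂ (r′ , e′ , lt) with normalise′ l r′ (ℕₚ.≤-trans (ℕₚ.<⇒≤ lt) (ℕₚ.≤-trans r≤v h))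
    ...     | r″ , red″ , e″ , r″≤r′ =
              r″ , red″ , ∷-cong t (e ∙ e′) ∙ ∷-cancel t r′ ∙ e″
              , ℕₚ.m≤n⇒m≤1+n (ℕₚ.≤-trans r″≤r′ (ℕₚ.≤-trans (ℕₚ.<⇒≤ lt) r≤v))

  -- The first letter t of a reduced word is a descent, and signs depend only on the group element.
  -- So `exchange` applied to any equivalent v cannot return an ascent; it returns a shorter word
  -- with t split off, and t cancels on both sides.
  reduced-minimal : ∀ {r v} → Reduced r → v ≈ r → length r ≤ length v
  reduced-minimal [] e = z≤n
  reduced-minimal {t ∷ r} {v} (a ∷ red) e with exchange v t
  ... | inj₁ b = contradiction (descent-≈ (≈-sym e) (ascent-flip a)) (ascent-descent b)
  ... | inj₂ (v′ , e′ , lt) = ℕₚ.≤-trans (s≤s (reduced-minimal red (∷-cancelˡ (≈-sym e′ ∙ e)))) lt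

  opaque
    normalise : ∀ w → Σ W λ r → Reduced r × (w ≈ r) × length r ≤ length w
    normalise w = normalise′ (length w) w ℕₚ.≤-refl

  nf : W → W
  nf w = proj₁ (normalise w)

  nf-reduced : ∀ w → Reduced (nf w)
  nf-reduced w = proj₁ (proj₂ (normalise w))

  nf-≈ : ∀ w → w ≈ nf w
  nf-≈ w = proj₁ (proj₂ (proj₂ (normalise w)))

  opaque
    ℓ : W → ℕ
    ℓ w = length (nf w)

    ℓ-nf : ∀ w → length (nf w) ≡ ℓ w
    ℓ-nf w = refl

    ℓ-reduced : ∀ {r} → Reduced r → ℓ r ≡ length r
    ℓ-reduced {r} red = ℕₚ.≤-antisym (proj₂ (proj₂ (proj₂ (normalise r))))
                                     (reduced-minimal red (≈-sym (nf-≈ r)))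

    ℓ-cong : ∀ {u v} → u ≈ v → ℓ u ≡ ℓ v
    ℓ-cong {u} {v} e = ℕₚ.≤-antisym
      (reduced-minimal (nf-reduced u) (≈-sym (nf-≈ v) ∙ ≈-sym e ∙ nf-≈ u))
      (reduced-minimal (nf-reduced v) (≈-sym (nf-≈ u) ∙ e ∙ nf-≈ v))

    ℓ≤length : ∀ w → ℓ w ≤ length w
    ℓ≤length w = proj₂ (proj₂ (proj₂ (normalise w)))

  ℓ-++ : ∀ u v → ℓ (u ++ v) ≤ ℓ u + ℓ v
  ℓ-++ u v = begin
    ℓ (u ++ v)                   ≡⟨ ℓ-cong (++-cong (nf-≈ u) (nf-≈ v)) ⟩
    ℓ (nf u ++ nf v)             ≤⟨ ℓ≤length (nf u ++ nf v) ⟩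
    length (nf u ++ nf v)        ≡⟨ Listₚ.length-++ (nf u) ⟩
    length (nf u) + length (nf v) ≡⟨ cong₂ _+_ (ℓ-nf u) (ℓ-nf v) ⟩
    ℓ u + ℓ v                    ∎
    where open ℕₚ.≤-Reasoning

  ℓ-inv-≤ : ∀ w → ℓ (inv w) ≤ ℓ w
  ℓ-inv-≤ w = begin
    ℓ (inv w)            ≡⟨ ℓ-cong (inv-cong (nf-≈ w)) ⟩
    ℓ (inv (nf w))       ≤⟨ ℓ≤length (inv (nf w)) ⟩
    length (inv (nf w))  ≡⟨ Listₚ.length-reverse (nf w) ⟩
    length (nf w)        ≡⟨ ℓ-nf w ⟩
    ℓ w                  ∎
    where open ℕₚ.≤-Reasoning

  ℓ-inv : ∀ w → ℓ (inv w) ≡ ℓ w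
  ℓ-inv w = ℕₚ.≤-antisym (ℓ-inv-≤ w)
    (subst (λ v → ℓ v ≤ ℓ (inv w)) (Listₚ.reverse-involutive w) (ℓ-inv-≤ (inv w)))

  ℓ-ascent : ∀ {t w} → Ascent t w → ℓ (t ∷ w) ≡ suc (ℓ w)
  ℓ-ascent {t} {w} a = begin
    ℓ (t ∷ w)          ≡⟨ ℓ-cong (∷-cong t (nf-≈ w)) ⟩
    ℓ (t ∷ nf w)       ≡⟨ ℓ-reduced (ascent-≈ (nf-≈ w) a ∷ nf-reduced w) ⟩
    suc (length (nf w)) ≡⟨ cong suc (ℓ-nf w) ⟩
    suc (ℓ w)          ∎
    where open ≡-Reasoning

  ℓ-descent : ∀ {t w} → Descent t w → ℓ w ≡ suc (ℓ (t ∷ w))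
  ℓ-descent {t} {w} d = trans (ℓ-cong (≈-sym (∷-cancel t w))) (ℓ-ascent (descent-flip d))

  -- No simple form vanishes on the orbit of ρ. If the normal form begins with t up to `≈`, the
  -- remainder has t as an ascent, since splitting off t a second time would give a word shorter
  -- than the normal form.
  ascent-or-descent : ∀ t w → Ascent t w ⊎ Descent t w
  ascent-or-descent t w with exchange (nf w) t
  ... | inj₁ a = inj₁ (ascent-≈ (≈-sym (nf-≈ w)) a)
  ... | inj₂ (v , e , lt) with exchange v t
  ...   | inj₁ a = inj₂ (descent-≈ (≈-sym e ∙ ≈-sym (nf-≈ w)) (ascent-flip a))
  ...   | inj₂ (v′ , e′ , lt′) = contradiction
            (reduced-minimal (nf-reduced w) (≈-sym (e ∙ ∷-cong t e′ ∙ ∷-cancel t v′)))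
            (ℕₚ.<⇒≱ (ℕₚ.<-trans lt′ lt))

  longer⇒ascent : ∀ {t w} → ℓ w < ℓ (t ∷ w) → Ascent t w
  longer⇒ascent {t} {w} lt with ascent-or-descent t w
  ... | inj₁ a = a
  ... | inj₂ d = contradiction (ℕₚ.≤-reflexive (sym (ℓ-descent d))) (ℕₚ.<⇒≱ (ℕₚ.m≤n⇒m≤1+n lt))

  shorter⇒descent : ∀ {t w} → ℓ (t ∷ w) < ℓ w → Descent t w
  shorter⇒descent {t} {w} lt with ascent-or-descent t w
  ... | inj₂ d = d
  ... | inj₁ a = contradiction (ℕₚ.≤-reflexive (sym (ℓ-ascent a))) (ℕₚ.<⇒≱ (ℕₚ.m≤n⇒m≤1+n lt))

  ≈[]-or-descent : ∀ w → w ≈ [] ⊎ Σ (Gen (2 + n)) λ t → Descent t w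
  ≈[]-or-descent w with nf w | nf-reduced w | nf-≈ w
  ... | []    | _     | e = inj₁ e
  ... | t ∷ r | a ∷ _ | e = inj₂ (t , descent-≈ (≈-sym e) (ascent-flip a))

  -- The quotient of two words with the same point fixes ρ, where every form is positive. It has no
  -- descent, hence it is trivial.
  point-injective : ∀ {u v} → point u ≡ point v → u ≈ v
  point-injective {u} {v} eq with ≈[]-or-descent (inv v ++ u)
  ... | inj₁ e = ≈-sym (inv-cancelʳ v u) ∙ ++-congˡ v e ∙ ≈-reflexive (Listₚ.++-identityʳ v)
  ... | inj₂ (t , d) = contradiction d
          (ascent-descent (ascent (subst (λ p → 0ℤ ℤ.< form t p) (sym fixed) (form-ρ t))))
    where
    open ≡-Reasoning
    fixed : point (inv v ++ u) ≡ ρ (2 + n)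
    fixed = begin
      point (inv v ++ u)          ≡⟨ actW-++ (inv v) u _ ⟩
      actW (inv v) (point u)      ≡⟨ cong (actW (inv v)) eq ⟩
      actW (inv v) (point v)      ≡⟨ actW-++ (inv v) v _ ⟨
      point (inv v ++ v)          ≡⟨ cong (λ x → point (inv v ++ x)) (Listₚ.++-identityʳ v) ⟨
      point (inv v ++ (v ++ []))  ≡⟨ point-≈ (inv-cancelˡ v []) ⟩
      ρ (2 + n)                   ∎

  length-ℓ : ∀ w → Length w (ℓ w)
  length-ℓ w = (nf w , ≈-sym (nf-≈ w) , ℓ-nf w) , λ v e → subst (_≤ length v) (ℓ-cong e) (ℓ≤length v)

  length-unique : ∀ {w l} → Length w l → l ≡ ℓ w
  length-unique {w} ((v , e , refl) , low) = ℕₚ.≤-antisym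
    (subst (length v ≤_) (ℓ-nf w) (low (nf w) (≈-sym (nf-≈ w))))
    (subst (_≤ length v) (ℓ-cong e) (ℓ≤length v))

-- Weak order

infix 4 _≼_

_≼_ : ∀ {n} → Word (2 + n) → Word (2 + n) → Set
u ≼ w = ℓ w ≡ ℓ u + ℓ (inv u ++ w)

opaque
  ≤R⇒≼ : ∀ {n} {u w : Word (2 + n)} → u ≤R w → u ≼ w
  ≤R⇒≼ (a , b , c , La , Lb , Lc , eq) =
    trans (sym (length-unique Lb)) (trans eq (cong₂ _+_ (length-unique La) (length-unique Lc)))

  ≼⇒≤R : ∀ {n} {u w : Word (2 + n)} → u ≼ w → u ≤R w
  ≼⇒≤R {u = u} {w} h = _ , _ , _ , length-ℓ u , length-ℓ w , length-ℓ (inv u ++ w) , h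

≼-cong : ∀ {n} {u u′ w w′ : Word (2 + n)} → u ≈ u′ → w ≈ w′ → u ≼ w → u′ ≼ w′
≼-cong {u = u} {u′} {w} {w′} e f h = begin
  ℓ w′                     ≡⟨ ℓ-cong f ⟨
  ℓ w                      ≡⟨ h ⟩
  ℓ u + ℓ (inv u ++ w)     ≡⟨ cong₂ _+_ (ℓ-cong e) (ℓ-cong (++-cong (inv-cong e) f)) ⟩
  ℓ u′ + ℓ (inv u′ ++ w′)  ∎
  where open ≡-Reasoning

ℓ-[] : ∀ {n} → ℓ {n} [] ≡ 0
ℓ-[] = ℓ-reduced []

opaque
  -- Subadditivity of `ℓ` gives the other inequality for free, and any word x for the quotient
  -- bounds its length from above.
  ≼-intro : ∀ {n} {u w : Word (2 + n)} x → w ≈ (u ++ x) → ℓ u + length x ≤ ℓ w → u ≼ w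
  ≼-intro {u = u} {w} x e h = ℕₚ.≤-antisym
    (ℕₚ.≤-trans (ℕₚ.≤-reflexive (ℓ-cong (≈-sym (inv-cancelʳ u w)))) (ℓ-++ u (inv u ++ w)))
    (ℕₚ.≤-trans (ℕₚ.+-monoʳ-≤ (ℓ u) (ℕₚ.≤-trans (ℕₚ.≤-reflexive (ℓ-cong (++-congˡ (inv u) e ∙ inv-cancelˡ u x))) (ℓ≤length x))) h)

  ≼-reflexive : ∀ {n} {u w : Word (2 + n)} → u ≈ w → u ≼ w
  ≼-reflexive {u = u} {w} e = ≼-intro [] (≈-sym e ∙ ≈-reflexive (sym (Listₚ.++-identityʳ u)))
    (ℕₚ.≤-reflexive (trans (ℕₚ.+-identityʳ (ℓ u)) (ℓ-cong e)))

  inv-++-inv : ∀ {n} (u v w : Word n) → ((inv u ++ v) ++ (inv v ++ w)) ≈ (inv u ++ w)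
  inv-++-inv u v w = ≈-assoc (inv u) v (inv v ++ w) ∙ ++-congˡ (inv u) (inv-cancelʳ v w)

  ≼-trans : ∀ {n} {u v w : Word (2 + n)} → u ≼ v → v ≼ w → u ≼ w
  ≼-trans {u = u} {v} {w} h k = ℕₚ.≤-antisym
    (ℕₚ.≤-trans (ℕₚ.≤-reflexive (ℓ-cong (≈-sym (inv-cancelʳ u w)))) (ℓ-++ u (inv u ++ w)))
    (begin
      ℓ u + ℓ (inv u ++ w)                        ≡⟨ cong (_+_ (ℓ u)) (ℓ-cong (inv-++-inv u v w)) ⟨
      ℓ u + ℓ ((inv u ++ v) ++ (inv v ++ w))      ≤⟨ ℕₚ.+-monoʳ-≤ (ℓ u) (ℓ-++ (inv u ++ v) (inv v ++ w)) ⟩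
      ℓ u + (ℓ (inv u ++ v) + ℓ (inv v ++ w))     ≡⟨ ℕₚ.+-assoc (ℓ u) _ _ ⟨
      (ℓ u + ℓ (inv u ++ v)) + ℓ (inv v ++ w)     ≡⟨ cong (_+ ℓ (inv v ++ w)) h ⟨
      ℓ v + ℓ (inv v ++ w)                        ≡⟨ k ⟨
      ℓ w                                         ∎)
    where open ℕₚ.≤-Reasoning

  ≼⇒ℓ≤ : ∀ {n} {u w : Word (2 + n)} → u ≼ w → ℓ u ≤ ℓ w
  ≼⇒ℓ≤ h = subst (_ ≤_) (sym h) (ℕₚ.m≤m+n _ _)

  ≼-antisym : ∀ {n} {u w : Word (2 + n)} → u ≼ w → w ≼ u → u ≈ w
  ≼-antisym {n} {u} {w} h k with ≈[]-or-descent (inv u ++ w)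
  ... | inj₁ e = ≈-reflexive (sym (Listₚ.++-identityʳ u)) ∙ ++-congˡ u (≈-sym e) ∙ inv-cancelʳ u w
  ... | inj₂ (t , d) = contradiction (≼⇒ℓ≤ k)
          (ℕₚ.<⇒≱ (subst (ℓ u <_) (sym h) (ℕₚ.m<m+n (ℓ u) (subst (0 <_) (sym (ℓ-descent d)) (s≤s z≤n)))))

  inv-snoc : ∀ {n} (u : Word n) t → inv (u ++ [ t ]) ≡ t ∷ inv u
  inv-snoc u t = inv-++ u [ t ]

  ℓ-snoc : ∀ {n} (u : Word (2 + n)) t → ℓ (u ++ [ t ]) ≡ ℓ (t ∷ inv u)
  ℓ-snoc u t = trans (sym (ℓ-inv (u ++ [ t ]))) (cong ℓ (inv-snoc u t))

  ℓ-snoc-ascent : ∀ {n} {u : Word (2 + n)} {t} → Ascent t (inv u) → ℓ (u ++ [ t ]) ≡ suc (ℓ u)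
  ℓ-snoc-ascent {u = u} {t} a = trans (ℓ-snoc u t) (trans (ℓ-ascent a) (cong suc (ℓ-inv u)))

  ≼-snoc : ∀ {n} {u : Word (2 + n)} {t} → Ascent t (inv u) → u ≼ (u ++ [ t ])
  ≼-snoc {u = u} {t} a = ≼-intro [ t ] (≈-refl _)
    (ℕₚ.≤-reflexive (trans (ℕₚ.+-comm (ℓ u) 1) (sym (ℓ-snoc-ascent a))))

  snoc-⋠ : ∀ {n} {u : Word (2 + n)} {t} → Ascent t (inv u) → ¬ ((u ++ [ t ]) ≼ u)
  snoc-⋠ a h = contradiction (≼⇒ℓ≤ h) (ℕₚ.<⇒≱ (ℕₚ.≤-reflexive (sym (ℓ-snoc-ascent a))))

module _ {n : ℕ} {u w : Word (2 + n)} {t : Gen (2 + n)} (u≼w : u ≼ w) where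

  private
    x = inv u ++ w

    snoc-quotient : inv (u ++ [ t ]) ++ w ≡ t ∷ x
    snoc-quotient = cong (_++ w) (inv-snoc u t)

  opaque
    -- As u lies below w, reduced words of u and of the quotient x concatenate to a reduced word of
    -- w. A left descent t of x may be taken as the first letter of the second word and then moved
    -- over to u.
    descent⇒snoc-≼ : Descent t x → (u ++ [ t ]) ≼ w
    descent⇒snoc-≼ d = ℕₚ.≤-antisym
        (ℕₚ.≤-trans (ℕₚ.≤-reflexive (ℓ-cong (≈-sym (inv-cancelʳ (u ++ [ t ]) w)))) (ℓ-++ (u ++ [ t ]) _))
        (begin
          ℓ (u ++ [ t ]) + ℓ (inv (u ++ [ t ]) ++ w)  ≡⟨ cong (λ v → ℓ (u ++ [ t ]) + ℓ v) snoc-quotient ⟩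
          ℓ (u ++ [ t ]) + ℓ (t ∷ x)                  ≤⟨ ℕₚ.+-monoˡ-≤ _ (ℕₚ.≤-trans (ℓ-++ u [ t ]) (ℕₚ.+-monoʳ-≤ (ℓ u) (ℓ≤length [ t ]))) ⟩
          (ℓ u + 1) + ℓ (t ∷ x)                       ≡⟨ ℕₚ.+-assoc (ℓ u) 1 _ ⟩
          ℓ u + suc (ℓ (t ∷ x))                       ≡⟨ cong (_+_ (ℓ u)) (ℓ-descent d) ⟨
          ℓ u + ℓ x                                   ≡⟨ u≼w ⟨
          ℓ w                                         ∎)
      where open ℕₚ.≤-Reasoning

    descent⇒ascent : Descent t x → Ascent t (inv u)
    descent⇒ascent d = longer⇒ascent (ℕₚ.≤-reflexive (sym (trans (sym (ℓ-snoc u t))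
      (trans (ℕₚ.+-cancelʳ-≡ (ℓ (t ∷ x)) _ _ (begin
        ℓ (u ++ [ t ]) + ℓ (t ∷ x)                  ≡⟨ cong (λ v → ℓ (u ++ [ t ]) + ℓ v) snoc-quotient ⟨
        ℓ (u ++ [ t ]) + ℓ (inv (u ++ [ t ]) ++ w)  ≡⟨ descent⇒snoc-≼ d ⟨
        ℓ w                                         ≡⟨ u≼w ⟩
        ℓ u + ℓ x                                   ≡⟨ cong (_+_ (ℓ u)) (ℓ-descent d) ⟩
        ℓ u + suc (ℓ (t ∷ x))                       ≡⟨ ℕₚ.+-suc (ℓ u) _ ⟩
        suc (ℓ u) + ℓ (t ∷ x)                       ∎))
      (cong suc (sym (ℓ-inv u)))))))
      where open ≡-Reasoning

    snoc-≼⇒descent : Ascent t (inv u) → (u ++ [ t ]) ≼ w → Descent t x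
    snoc-≼⇒descent a h = shorter⇒descent (ℕₚ.≤-reflexive (ℕₚ.+-cancelˡ-≡ (ℓ u) _ _ (begin
        ℓ u + suc (ℓ (t ∷ x))                       ≡⟨ ℕₚ.+-suc (ℓ u) _ ⟩
        suc (ℓ u) + ℓ (t ∷ x)                       ≡⟨ cong (_+ ℓ (t ∷ x)) (ℓ-snoc-ascent a) ⟨
        ℓ (u ++ [ t ]) + ℓ (t ∷ x)                  ≡⟨ cong (λ v → ℓ (u ++ [ t ]) + ℓ v) snoc-quotient ⟨
        ℓ (u ++ [ t ]) + ℓ (inv (u ++ [ t ]) ++ w)  ≡⟨ h ⟨
        ℓ w                                         ≡⟨ u≼w ⟩
        ℓ u + ℓ x                                   ∎)))
      where open ≡-Reasoning

-- Commuting sets of generators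

Commute : ∀ {n} → Gen n → Gen n → Set
Commute t r = m t r ≡ 2

Commuting : ∀ {n} → Word n → Set
Commuting = AllPairs Commute

commute-sym : ∀ {n} {t r : Gen n} → Commute t r → Commute r t
commute-sym {t = t} {r} e = trans (m-sym r t) e

commute-irrefl : ∀ {n} {t : Gen n} → ¬ Commute t t
commute-irrefl {t = t} e with trans (sym (m-self t)) e
... | ()

_≟_ : ∀ {n} (t r : Gen n) → Dec (t ≡ r)
t ≟ r with bond t r
... | same e    = yes e
... | commute e = no λ { refl → commute-irrefl {t = t} e }
... | braid e   = no λ { refl → contradiction (trans (sym (m-self t)) e) λ () }

commuting-↭ : ∀ {n} {l k : Word n} → l ↭ k → Commuting l → Commuting k
commuting-↭ p = ↭ₛ.AllPairs-resp-↭ (setoid _) (λ {t} {r} → commute-sym {t = t} {r})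
  (resp₂ Commute) (↭⇒↭ₛ p)

↭⇒≈ : ∀ {n} {l k : Word n} → l ↭ k → Commuting l → l ≈ k
↭⇒≈ ↭.refl        c             = ≈-refl _
↭⇒≈ (↭.prep t p)    (_ ∷ c)       = ∷-cong t (↭⇒≈ p c)
↭⇒≈ (↭.swap t r p)  ((e ∷ _) ∷ _ ∷ c) = commute-≈ e _ ∙ ∷-cong r (∷-cong t (↭⇒≈ p c))
↭⇒≈ (↭.trans p q)   c             = ↭⇒≈ p c ∙ ↭⇒≈ q (commuting-↭ p c)

module _ {n : ℕ} where

  private variable
    t r : Gen (2 + n)
    u w : Word (2 + n)

  ascent-∷ : Commute t r → Ascent r w → Ascent r (t ∷ w)
  ascent-∷ {t} {r} {w} e (ascent a) =
    ascent (subst (0ℤ ℤ.<_) (sym (form-act-commute t r e (point w))) a)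

  descent-∷ : Commute t r → Descent r w → Descent r (t ∷ w)
  descent-∷ {t} {r} {w} e (descent d) =
    descent (subst (ℤ._< 0ℤ) (sym (form-act-commute t r e (point w))) d)

  ascent-snoc : ∀ u → Commute t r → Ascent r (inv u) → Ascent r (inv (u ++ [ t ]))
  ascent-snoc {t} {r} u e a = subst (Ascent r) (sym (inv-snoc u t)) (ascent-∷ e a)

  descent-snoc : ∀ u → Commute t r → Descent r (inv u) → Descent r (inv (u ++ [ t ]))
  descent-snoc {t} {r} u e a = subst (Descent r) (sym (inv-snoc u t)) (descent-∷ e a)

  Ascents : Word (2 + n) → Word (2 + n) → Set
  Ascents u = All (λ t → Ascent t (inv u))

  ascents-snoc : ∀ u {l} → All (Commute t) l → Ascents u l → Ascents (u ++ [ t ]) l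
  ascents-snoc         u []      []      = []
  ascents-snoc {t = t} u (e ∷ c) (a ∷ A) = ascent-snoc {t = t} u e a ∷ ascents-snoc u c A

  ℓ-commuting : ∀ {u l} → Commuting l → Ascents u l → ℓ (u ++ l) ≡ ℓ u + length l
  ℓ-commuting {u} [] [] = trans (cong ℓ (Listₚ.++-identityʳ u)) (sym (ℕₚ.+-identityʳ (ℓ u)))
  ℓ-commuting {u} {t ∷ l} (c ∷ C) (a ∷ A) = begin
    ℓ (u ++ t ∷ l)             ≡⟨ cong ℓ (Listₚ.++-assoc u [ t ] l) ⟨
    ℓ ((u ++ [ t ]) ++ l)      ≡⟨ ℓ-commuting C (ascents-snoc u c A) ⟩
    ℓ (u ++ [ t ]) + length l  ≡⟨ cong (_+ length l) (ℓ-snoc-ascent a) ⟩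
    suc (ℓ u) + length l       ≡⟨ ℕₚ.+-suc (ℓ u) (length l) ⟨
    ℓ u + suc (length l)       ∎
    where open ≡-Reasoning

  ascents-[] : ∀ l → Ascents [] l
  ascents-[] l = All.tabulate λ {t} _ → ascent (form-ρ t)

  -- Multiplying by r can only add the form of r to that of t. In the braid case r does not recur in
  -- the rest of l, because no generator commutes with itself, so by induction both summands are
  -- positive.
  ∉⇒ascent : ∀ {l} → Commuting l → t ∉ l → Ascent t l
  ∉⇒ascent {t} {[]}    _       _  = ascent (form-ρ t)
  ∉⇒ascent {t} {r ∷ l} (c ∷ C) t∉ with bond r t
  ... | same e    = contradiction (here (sym e)) t∉
  ... | commute e = ascent-∷ e (∉⇒ascent C (λ t∈ → t∉ (there t∈)))
  ... | braid e   with ∉⇒ascent {r} C (λ r∈ → commute-irrefl {t = r} (All.lookup c r∈))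
                     | ∉⇒ascent {t} C (λ t∈ → t∉ (there t∈))
  ...   | ascent a | ascent b =
          ascent (subst (0ℤ ℤ.<_) (sym (form-act-braid r t e (point l))) (ℤₚ.+-mono-< a b))

  descent⇒∈ : ∀ {l} → Commuting l → Descent t l → t ∈ l
  descent⇒∈ {t} {l} c d with ∈? _≟_ t l
  ... | yes t∈ = t∈
  ... | no  t∉ = contradiction d (ascent-descent (∉⇒ascent c t∉))

  -- Every left factor of a product of commuting generators is a subproduct. Additivity of lengths
  -- makes the first letter of x a descent of the product, hence a member of l; it is moved to the
  -- front of l and cancelled.
  commuting-split : ∀ x y {l} → Commuting l → (x ++ y) ≈ l → length x + ℓ y ≤ length l →
                    Σ (Word (2 + n)) λ k → Σ (Word (2 + n)) λ r → (l ↭ k ++ r) × (x ≈ k)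
  commuting-split []      y {l} c e h = [] , l , ↭-refl , ≈-refl []
  commuting-split (t ∷ x) y {l} c e h with ∈-∃++ (descent⇒∈ c t-descent)
    where
    t-descent : Descent t l
    t-descent = shorter⇒descent (begin-strict
      ℓ (t ∷ l)           ≡⟨ ℓ-cong (≈-sym (∷-cancel t (x ++ y)) ∙ ∷-cong t e) ⟨
      ℓ (x ++ y)          ≤⟨ ℓ-++ x y ⟩
      ℓ x + ℓ y           ≤⟨ ℕₚ.+-monoˡ-≤ (ℓ y) (ℓ≤length x) ⟩
      length x + ℓ y      <⟨ h ⟩
      length l            ≡⟨ cong (_+ length l) ℓ-[] ⟨
      ℓ {n} [] + length l ≡⟨ ℓ-commuting c (ascents-[] l) ⟨
      ℓ l                 ∎)
      where open ℕₚ.≤-Reasoning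
  ... | a , b , refl with shift t a b
  ...   | p with commuting-↭ p c
  ...     | _ ∷ c′ with commuting-split x y c′ (∷-cancelˡ (e ∙ ↭⇒≈ p c)) (ℕₚ.≤-pred (ℕₚ.≤-trans h (ℕₚ.≤-reflexive (↭-length p))))
  ...       | k , r , q , f = t ∷ k , r , ↭-trans p (↭.prep t q) , ∷-cong t f

  -- Once t has been moved from the quotient to u, the remaining letters are still descents of the
  -- quotient, because they commute with t. This yields the least-upper-bound property of the
  -- product over its atoms.
  descents-≼ : ∀ {u w l} → Commuting l → u ≼ w → All (λ t → Descent t (inv u ++ w)) l → (u ++ l) ≼ w
  descents-≼ {u} {w} [] h [] = subst (_≼ w) (sym (Listₚ.++-identityʳ u)) h
  descents-≼ {u} {w} {t ∷ l} (c ∷ C) h (d ∷ D) = subst (_≼ w) (Listₚ.++-assoc u [ t ] l)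
    (descents-≼ C (descent⇒snoc-≼ h d) (All.zipWith (λ { {r} (e , d′) →
       subst (Descent r) (sym (cong (_++ w) (inv-snoc u t))) (descent-∷ e d′) }) (c , D)))

  prefix-≼ : ∀ {u l} k {r} → Commuting l → Ascents u l → l ↭ k ++ r → (u ++ k) ≼ (u ++ l)
  prefix-≼ {u} {l} k {r} C A p = ≼-intro r
    (++-congˡ u (↭⇒≈ p C) ∙ ≈-sym (≈-assoc u k r))
    (begin
      ℓ (u ++ k) + length r           ≤⟨ ℕₚ.+-monoˡ-≤ (length r) (ℕₚ.≤-trans (ℓ-++ u k) (ℕₚ.+-monoʳ-≤ (ℓ u) (ℓ≤length k))) ⟩
      (ℓ u + length k) + length r     ≡⟨ ℕₚ.+-assoc (ℓ u) _ _ ⟩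
      ℓ u + (length k + length r)     ≡⟨ cong (_+_ (ℓ u)) (trans (sym (Listₚ.length-++ k)) (sym (↭-length p))) ⟩
      ℓ u + length l                  ≡⟨ ℓ-commuting C A ⟨
      ℓ (u ++ l)                      ∎)
    where open ℕₚ.≤-Reasoning

-- Boolean intervals

select : ∀ {A : Set} {k} → Vec A k → Subset k → List A
select []       []            = []
select (x ∷ xs) (inside  ∷ S) = x ∷ select xs S
select (x ∷ xs) (outside ∷ S) = select xs S

select-⊤ : ∀ {A : Set} {k} (xs : Vec A k) → select xs ⊤ ≡ toList xs
select-⊤ []       = refl
select-⊤ (x ∷ xs) = cong (x ∷_) (select-⊤ xs)

All-select : ∀ {A : Set} {P : A → Set} {k} (xs : Vec A k) S → All P (toList xs) → All P (select xs S)
All-select []       []            []       = []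
All-select (x ∷ xs) (inside  ∷ S) (p ∷ ps) = p ∷ All-select xs S ps
All-select (x ∷ xs) (outside ∷ S) (p ∷ ps) = All-select xs S ps

commuting-select : ∀ {n k} (J : Vec (Gen n) k) S → Commuting (toList J) → Commuting (select J S)
commuting-select []      []            []      = []
commuting-select (t ∷ J) (inside  ∷ S) (c ∷ C) = All-select J S c ∷ commuting-select J S C
commuting-select (t ∷ J) (outside ∷ S) (c ∷ C) = commuting-select J S C

select-⊆ : ∀ {A : Set} {k} (xs : Vec A k) K L → K ⊆ L → Σ (List A) λ r → select xs L ↭ select xs K ++ r
select-⊆ []       []            []            sub = [] , ↭-refl
select-⊆ (x ∷ xs) (outside ∷ K) (outside ∷ L) sub = select-⊆ xs K L (drop-∷-⊆ sub)
select-⊆ (x ∷ xs) (inside ∷ K)  (outside ∷ L) sub with sub {zero} Vec.here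
... | ()
select-⊆ (x ∷ xs) (inside ∷ K)  (inside ∷ L)  sub with select-⊆ xs K L (drop-∷-⊆ sub)
... | r , p = r , ↭.prep x p
select-⊆ (x ∷ xs) (outside ∷ K) (inside ∷ L)  sub with select-⊆ xs K L (drop-∷-⊆ sub)
... | r , p = x ∷ r , ↭-trans (↭.prep x p) (↭-sym (shift x (select xs K) r))

-- Turns a sublist, known only up to order, back into a set of positions: each selected position is
-- kept or dropped according to the side on which an occurrence of its entry is found.
split-select : ∀ {A : Set} {k} (xs : Vec A k) L a b → select xs L ↭ a ++ b →
               Σ (Subset k) λ K → K ⊆ L × select xs K ↭ a
split-select []       []            []      b p = [] , (λ z → z) , ↭-refl
split-select []       []            (y ∷ a) b p with ↭-empty-inv (↭-sym p)
... | ()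
split-select (x ∷ xs) (outside ∷ L) a       b p with split-select xs L a b p
... | K , sub , q = outside ∷ K , out⊆ sub , q
split-select (x ∷ xs) (inside ∷ L)  a       b p with ∈-++⁻ a (∈-resp-↭ p (here refl))
... | inj₁ x∈a with ∈-∃++ x∈a
...   | a₁ , a₂ , refl with split-select xs L (a₁ ++ a₂) b (drop-∷ (↭-trans p (++⁺ʳ b (shift x a₁ a₂))))
...     | K , sub , q = inside ∷ K , in⊆in sub , ↭-trans (↭.prep x q) (↭-sym (shift x a₁ a₂))
split-select (x ∷ xs) (inside ∷ L)  a       b p | inj₂ x∈b with ∈-∃++ x∈b
...   | b₁ , b₂ , refl with split-select xs L a (b₁ ++ b₂)
                             (drop-∷ (↭-trans p (subst₂ _↭_ (Listₚ.++-assoc a b₁ (x ∷ b₂))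
                                                          (cong (x ∷_) (Listₚ.++-assoc a b₁ b₂))
                                                          (shift x (a ++ b₁) b₂))))
...     | K , sub , q = outside ∷ K , out⊆ sub , q

module _ {n : ℕ} where

  opaque
    isDescent : Word (2 + n) → Gen (2 + n) → Bool
    isDescent w t = [ (λ _ → false) , (λ _ → true) ]′ (ascent-or-descent t w)

    isDescent-ascent : ∀ w {t} → Ascent t w → isDescent w t ≡ false
    isDescent-ascent w {t} a with ascent-or-descent t w
    ... | inj₁ _ = refl
    ... | inj₂ d = contradiction d (ascent-descent a)

    isDescent-descent : ∀ w {t} → Descent t w → isDescent w t ≡ true
    isDescent-descent w {t} d with ascent-or-descent t w
    ... | inj₁ a = contradiction d (ascent-descent a)
    ... | inj₂ _ = refl

    isDescent-≈ : ∀ {v w} → v ≈ w → ∀ t → isDescent v t ≡ isDescent w t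
    isDescent-≈ {v} {w} e t with ascent-or-descent t w
    ... | inj₁ a = isDescent-ascent v (ascent-≈ (≈-sym e) a)
    ... | inj₂ d = isDescent-descent v (descent-≈ (≈-sym e) d)

  ascent-++ : ∀ (t : Gen (2 + n)) u {l} → All (λ r → Commute r t) l → Ascent t (inv u) → Ascent t (inv (u ++ l))
  ascent-++ t u []                a = subst (λ v → Ascent t (inv v)) (sym (Listₚ.++-identityʳ u)) a
  ascent-++ t u {r ∷ l} (e ∷ E) a =
    subst (λ v → Ascent t (inv v)) (Listₚ.++-assoc u [ r ] l)
      (ascent-++ t (u ++ [ r ]) E (ascent-snoc {t = r} u e a))

  descent-++ : ∀ (t : Gen (2 + n)) u {l} → All (λ r → Commute r t) l → Descent t (inv u) → Descent t (inv (u ++ l))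
  descent-++ t u []                a = subst (λ v → Descent t (inv v)) (sym (Listₚ.++-identityʳ u)) a
  descent-++ t u {r ∷ l} (e ∷ E) a =
    subst (λ v → Descent t (inv v)) (Listₚ.++-assoc u [ r ] l)
      (descent-++ t (u ++ [ r ]) E (descent-snoc {t = r} u e a))

  -- The inverse of sending S to u times the product of the labels in S. Since the labels are
  -- commuting ascents of u, appending one makes it a descent and leaves the others as they were; so
  -- S is recovered from the element alone.
  descentSet : ∀ {k} → Vec (Gen (2 + n)) k → Word (2 + n) → Subset k
  descentSet J v = Vec.map (isDescent (inv v)) J

  descentSet-≈ : ∀ {k} (J : Vec (Gen (2 + n)) k) {v w} → v ≈ w → descentSet J v ≡ descentSet J w
  descentSet-≈ []      e = refl
  descentSet-≈ (t ∷ J) e = cong₂ _∷_ (isDescent-≈ (inv-cong e) t) (descentSet-≈ J e)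

  descentSet-select : ∀ {k} (J : Vec (Gen (2 + n)) k) S u → Commuting (toList J) → Ascents u (toList J) →
                      descentSet J (u ++ select J S) ≡ S
  descentSet-select []      []            u C       A       = refl
  descentSet-select (t ∷ J) (inside  ∷ S) u (c ∷ C) (a ∷ A) = cong₂ _∷_
    (isDescent-descent (inv (u ++ select (t ∷ J) (inside ∷ S))) (subst (λ v → Descent t (inv v)) assoc
      (descent-++ t (u ++ [ t ]) (All-select J S (All.map (λ {r} → commute-sym {t = t} {r}) c))
        (subst (Descent t) (sym (inv-snoc u t)) (ascent-flip a)))))
    (trans (cong (descentSet J) (sym assoc)) (descentSet-select J S (u ++ [ t ]) C (ascents-snoc u c A)))
    where assoc = Listₚ.++-assoc u [ t ] (select J S)
  descentSet-select (t ∷ J) (outside ∷ S) u (c ∷ C) (a ∷ A) = cong₂ _∷_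
    (isDescent-ascent (inv (u ++ select J S)) (ascent-++ t u (All-select J S (All.map (λ {r} → commute-sym {t = t} {r}) c)) a))
    (descentSet-select J S u C A)

  -- With x a reduced word from u to v and y the quotient from v to the top, x y is the product of
  -- the selected labels and the lengths add up; `commuting-split` then makes x a subproduct.
  interval-select : ∀ {k} (J : Vec (Gen (2 + n)) k) L u {v} → Commuting (toList J) → Ascents u (toList J) →
                    u ≼ v → v ≼ (u ++ select J L) → Σ (Subset k) λ K → K ⊆ L × (v ≈ (u ++ select J K))
  interval-select J L u {v} C A h g with commuting-split x y Cl quotient (ℕₚ.≤-reflexive lengths)
    where
    l = select J L
    Cl = commuting-select J L C
    x = nf (inv u ++ v)
    y = inv v ++ (u ++ l)
    quotient : (x ++ y) ≈ l
    quotient = ++-congʳ y (≈-sym (nf-≈ (inv u ++ v))) ∙ inv-++-inv u v (u ++ l) ∙ inv-cancelˡ u l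
    open ≡-Reasoning
    lengths : length x + ℓ y ≡ length l
    lengths = ℕₚ.+-cancelˡ-≡ (ℓ u) _ _ (begin
      ℓ u + (length x + ℓ y)        ≡⟨ ℕₚ.+-assoc (ℓ u) _ _ ⟨
      (ℓ u + length x) + ℓ y        ≡⟨ cong (λ a → (ℓ u + a) + ℓ y) (ℓ-nf (inv u ++ v)) ⟩
      (ℓ u + ℓ (inv u ++ v)) + ℓ y  ≡⟨ cong (_+ ℓ y) h ⟨
      ℓ v + ℓ y                     ≡⟨ g ⟨
      ℓ (u ++ l)                    ≡⟨ ℓ-commuting Cl (All-select J L A) ⟩
      ℓ u + length l                ∎)
  ... | a , b , p , e with split-select J L a b p
  ...   | K , sub , q = K , sub ,
          (≈-sym (inv-cancelʳ u v)
           ∙ ++-congˡ u (nf-≈ (inv u ++ v) ∙ e ∙ ≈-sym (↭⇒≈ q (commuting-select J K C))))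

  select-≼ : ∀ {k} (J : Vec (Gen (2 + n)) k) K L u → Commuting (toList J) → Ascents u (toList J) →
             K ⊆ L → (u ++ select J K) ≼ (u ++ select J L)
  select-≼ J K L u C A sub = prefix-≼ (select J K) (commuting-select J L C) (All-select J L A)
                             (proj₂ (select-⊆ J K L sub))

  ≼-select : ∀ {k} (J : Vec (Gen (2 + n)) k) L u → Commuting (toList J) → Ascents u (toList J) →
             u ≼ (u ++ select J L)
  ≼-select J L u C A = ≼-intro (select J L) (≈-refl _)
    (ℕₚ.≤-reflexive (sym (ℓ-commuting (commuting-select J L C) (All-select J L A))))

  module _ {k} (J : Vec (Gen (2 + n)) k) {u} (C : Commuting (toList J)) (A : Ascents u (toList J)) where

    private
      w = u ++ select J ⊤

      f : Interval u w → Subset k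
      f (v , _) = descentSet J v

      g : Subset k → Interval u w
      g S = u ++ select J S , ≼⇒≤R (≼-select J S u C A) , ≼⇒≤R (select-≼ J S ⊤ u C A (λ _ → ∈⊤))

      fg : ∀ S → f (g S) ≡ S
      fg S = descentSet-select J S u C A

      -- Stated for general `L` to serve twice: `L = ⊤` gives one inverse law, and `L = f y` gives
      -- monotonicity of `f`.
      g-descentSet : ∀ {v} L → u ≼ v → v ≼ (u ++ select J L) →
                     (u ++ select J (descentSet J v)) ≈ v × descentSet J v ⊆ L
      g-descentSet L h h′ with interval-select J L u C A h h′
      ... | K , sub , e with trans (descentSet-≈ J e) (fg K)
      ...   | eq = (≈-reflexive (cong (λ S → u ++ select J S) eq) ∙ ≈-sym e) , subst (_⊆ L) (sym eq) sub

      gf : ∀ x → proj₁ (g (f x)) ≈ proj₁ x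
      gf (v , h , h′) = proj₁ (g-descentSet ⊤ (≤R⇒≼ h) (≤R⇒≼ h′))

      to : ∀ x y → proj₁ x ≤R proj₁ y → f x ⊆ f y
      to x@(_ , h , _) y x≤y =
        proj₂ (g-descentSet (f y) (≤R⇒≼ h) (≼-cong (≈-refl _) (≈-sym (gf y)) (≤R⇒≼ x≤y)))

      from : ∀ x y → f x ⊆ f y → proj₁ x ≤R proj₁ y
      from x y sub = ≼⇒≤R (≼-cong (gf x) (gf y) (select-≼ J (f x) (f y) u C A sub))

    commuting⇒boolean : u ≤R (u ++ toList J) × IsBooleanOfRank k u (u ++ toList J)
    commuting⇒boolean =
      subst (λ l → u ≤R (u ++ l) × IsBooleanOfRank k u (u ++ l)) (select-⊤ J)
            (≼⇒≤R (≼-select J ⊤ u C A) , f , g , gf , fg , λ x y → mk⇔ (to x y) (from x y))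

  -- Recovering commuting labels from an abstract Boolean isomorphism

  record CommutingLabels (k : ℕ) (u w : Word (2 + n)) : Set where
    field
      labels    : Word (2 + n)
      size      : length labels ≡ k
      commuting : Commuting labels
      ascents   : Ascents u labels
      top       : w ≈ (u ++ labels)

  module _ {k : ℕ} {u w : Word (2 + n)} (u≼w : u ≼ w)
    (f : Interval u w → Subset k) (g : Subset k → Interval u w) (fg : ∀ S → f (g S) ≡ S)
    (order-to   : ∀ x y → proj₁ x ≼ proj₁ y → f x ⊆ f y)
    (order-from : ∀ x y → f x ⊆ f y → proj₁ x ≼ proj₁ y) where

    private
      element : ∀ {v : Word (2 + n)} → u ≼ v → v ≼ w → Interval u w
      element {v} a b = v , ≼⇒≤R a , ≼⇒≤R b

      lower : ∀ (x : Interval u w) → u ≼ proj₁ x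
      lower x = ≤R⇒≼ (proj₁ (proj₂ x))

      upper : ∀ (x : Interval u w) → proj₁ x ≼ w
      upper x = ≤R⇒≼ (proj₂ (proj₂ x))

      bottom : Interval u w
      bottom = element (≼-reflexive (≈-refl u)) u≼w

      bottom-⊆ : ∀ S → f bottom ⊆ S
      bottom-⊆ S = subst (f bottom ⊆_) (fg S) (order-to bottom (g S) (lower (g S)))

      singleton-⊆ : ∀ {i : Fin k} {S} → i ∈ₛ S → ⁅ i ⁆ ⊆ S
      singleton-⊆ {i} i∈ j∈ = subst (_∈ₛ _) (sym (x∈⁅y⁆⇒x≡y i j∈)) i∈

      record Atom (i : Fin k) : Set where
        constructor mkAtom
        field
          label   : Gen (2 + n)
          up      : Ascent label (inv u)
          below   : (u ++ [ label ]) ≼ w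
          image   : f (element (≼-snoc up) below) ≡ ⁅ i ⁆
        cover : Interval u w
        cover = element (≼-snoc up) below

      -- The element a = `g ⁅ i ⁆` is not u, for otherwise i would lie in the image of the bottom,
      -- which is contained in every set. So the quotient from u to a has a left descent t. As u t
      -- is below a and not below u, its image is contained in the singleton and nonempty.
      atom : ∀ i → Atom i
      atom i with ≈[]-or-descent (inv u ++ proj₁ (g ⁅ i ⁆))
      ... | inj₁ e = contradiction
              (bottom-⊆ ⊥ (order-to (g ⁅ i ⁆) bottom ga≼u (subst (i ∈ₛ_) (sym (fg ⁅ i ⁆)) (x∈⁅x⁆ i)))) ∉⊥
        where
        a = proj₁ (g ⁅ i ⁆)
        ga≼u : a ≼ u
        ga≼u = ≼-reflexive (≈-sym (inv-cancelʳ u a) ∙ ++-congˡ u e ∙ ≈-reflexive (Listₚ.++-identityʳ u))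
      ... | inj₂ (t , d) = mkAtom t up below (⊆-antisym e⊆i (singleton-⊆ i∈e))
        where
        up : Ascent t (inv u)
        up = descent⇒ascent (lower (g ⁅ i ⁆)) d
        ut≼a : (u ++ [ t ]) ≼ proj₁ (g ⁅ i ⁆)
        ut≼a = descent⇒snoc-≼ (lower (g ⁅ i ⁆)) d
        below : (u ++ [ t ]) ≼ w
        below = ≼-trans ut≼a (upper (g ⁅ i ⁆))
        e = element (≼-snoc up) below
        e⊆i : f e ⊆ ⁅ i ⁆
        e⊆i = subst (f e ⊆_) (fg ⁅ i ⁆) (order-to e (g ⁅ i ⁆) ut≼a)
        i∈e : i ∈ₛ f e
        i∈e with i ∈ₛ? f e
        ... | yes i∈ = i∈
        ... | no  i∉ = contradiction (order-from e bottom e⊆u) (snoc-⋠ up)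
          where
          e⊆u : f e ⊆ f bottom
          e⊆u {j} j∈ = contradiction (subst (_∈ₛ f e) (x∈⁅y⁆⇒x≡y i (e⊆i j∈)) j∈) i∉

      open Atom

      label-descent : ∀ {i} (a : Atom i) (x : Interval u w) → i ∈ₛ f x → Descent (label a) (inv u ++ proj₁ x)
      label-descent a x i∈ = snoc-≼⇒descent (lower x) (up a)
        (order-from (cover a) x (subst (_⊆ f x) (sym (image a)) (singleton-⊆ i∈)))

      -- In the braid case let b correspond to {i, j}. Both t and r are descents of the quotient
      -- from u to b, and adding their negative forms shows that c = u t r is still below b. Since c
      -- is strictly above u t, its image must contain j, so u r is below c and r is a left descent
      -- of t r. But the form of r at t r equals that of t at ρ, which is positive.
      labels-commute : ∀ {i j} (a₁ : Atom i) (a₂ : Atom j) → i ≢ j → Commute (label a₁) (label a₂)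
      labels-commute {i} {j} a₁ a₂ i≢j with bond (label a₁) (label a₂)
      ... | commute e = e
      ... | same e    = contradiction (x∈⁅y⁆⇒x≡y j (i⊆j (x∈⁅x⁆ i))) i≢j
        where
        i⊆j : ⁅ i ⁆ ⊆ ⁅ j ⁆
        i⊆j = subst₂ _⊆_ (image a₁) (image a₂)
                (order-to (cover a₁) (cover a₂)
                          (≼-reflexive (≈-reflexive (cong (λ t → u ++ [ t ]) e))))
      ... | braid e   = contradiction
              (snoc-≼⇒descent (lower c) (up a₂) (order-from (cover a₂) c
                (subst (_⊆ f c) (sym (image a₂)) (singleton-⊆ j∈c))))
              (ascent-descent (ascent-≈ (≈-sym (≈-reflexive (cong (inv u ++_) (Listₚ.++-assoc u [ t ] [ r ])) ∙ inv-cancelˡ u (t ∷ r ∷ [])))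
                (ascent (subst (0ℤ ℤ.<_) (sym (form-act-braid² t r e (ρ (2 + n)))) (form-ρ t)))))
        where
        t = label a₁
        r = label a₂
        S = ⁅ i ⁆ ∪ ⁅ j ⁆
        b = g S
        i∈b : i ∈ₛ f b
        i∈b = subst (i ∈ₛ_) (sym (fg S)) (p⊆p∪q ⁅ j ⁆ (x∈⁅x⁆ i))
        j∈b : j ∈ₛ f b
        j∈b = subst (j ∈ₛ_) (sym (fg S)) (q⊆p∪q ⁅ i ⁆ ⁅ j ⁆ (x∈⁅x⁆ j))
        ut≼b : (u ++ [ t ]) ≼ proj₁ b
        ut≼b = descent⇒snoc-≼ (lower b) (label-descent a₁ b i∈b)
        d : Descent r (inv (u ++ [ t ]) ++ proj₁ b)
        d with label-descent a₁ b i∈b | label-descent a₂ b j∈b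
        ... | descent x | descent y = descent (subst (ℤ._< 0ℤ)
                (sym (trans (cong (λ v → form r (point (v ++ proj₁ b))) (inv-snoc u t))
                            (form-act-braid t r e (point (inv u ++ proj₁ b)))))
                (ℤₚ.+-mono-< x y))
        utr≼b : ((u ++ [ t ]) ++ [ r ]) ≼ proj₁ b
        utr≼b = descent⇒snoc-≼ ut≼b d
        utr-up : Ascent r (inv (u ++ [ t ]))
        utr-up = descent⇒ascent ut≼b d
        c : Interval u w
        c = element (≼-trans (≼-snoc (up a₁)) (≼-snoc utr-up)) (≼-trans utr≼b (upper b))
        j∈c : j ∈ₛ f c
        j∈c with j ∈ₛ? f c
        ... | yes j∈ = j∈
        -- Without j the image of c shrinks to {i}, which would put u t r below u t.
        ... | no  j∉ = contradiction (order-from c (cover a₁) c⊆i) (snoc-⋠ utr-up)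
          where
          c⊆i : f c ⊆ f (cover a₁)
          c⊆i {x} x∈ with x∈p∪q⁻ ⁅ i ⁆ ⁅ j ⁆ (subst (f c ⊆_) (fg S) (order-to c b utr≼b) x∈)
          ... | inj₁ x∈i = subst (x ∈ₛ_) (sym (image a₁)) x∈i
          ... | inj₂ x∈j = contradiction (subst (_∈ₛ f c) (x∈⁅y⁆⇒x≡y j x∈j) x∈) j∉

    -- The image of w contains every index, so all labels are descents of the quotient and the
    -- product u l is below w. Conversely u l is above every atom, so its image is full as well and
    -- w is below it.
    commutingLabels : CommutingLabels k u w
    commutingLabels = record
      { labels    = l
      ; size      = Listₚ.length-tabulate j
      ; commuting = C
      ; ascents   = A
      ; top       = ≼-antisym w≼ul ul≼w
      }
      where
      j : Fin k → Gen (2 + n)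
      j i = label (atom i)
      l = tabulate j
      C : Commuting l
      C = AllPairsₚ.tabulate⁺ (λ {i} {j} → labels-commute (atom i) (atom j))
      A : Ascents u l
      A = Allₚ.tabulate⁺ (λ i → up (atom i))
      x₁ : Interval u w
      x₁ = element u≼w (≼-reflexive (≈-refl w))
      full : ∀ S → S ⊆ f x₁
      full S = subst (_⊆ f x₁) (fg S) (order-to (g S) x₁ (upper (g S)))
      ul≼w : (u ++ l) ≼ w
      ul≼w = descents-≼ C u≼w (Allₚ.tabulate⁺ λ i → label-descent (atom i) x₁ (full ⁅ i ⁆ (x∈⁅x⁆ i)))
      z : Interval u w
      z = element (≼-intro l (≈-refl _) (ℕₚ.≤-reflexive (sym (ℓ-commuting C A)))) ul≼w
      cover≼z : ∀ i → (u ++ [ j i ]) ≼ (u ++ l)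
      cover≼z i with ∈-∃++ (∈-tabulate⁺ {f = j} i)
      ... | a , b , eq = prefix-≼ [ j i ] C A (subst (_↭ j i ∷ a ++ b) (sym eq) (shift (j i) a b))
      w≼ul : w ≼ (u ++ l)
      w≼ul = order-from x₁ z λ {i} _ →
        order-to (cover (atom i)) z (cover≼z i) (subst (i ∈ₛ_) (sym (image (atom i))) (x∈⁅x⁆ i))

  boolean⇒commuting : ∀ {k u w} → u ≤R w → IsBooleanOfRank k u w → CommutingLabels k u w
  boolean⇒commuting h (f , g , _ , fg , order) = commutingLabels (≤R⇒≼ h) f g fg
    (λ x y x≼y → Equivalence.to (order x y) (≼⇒≤R x≼y))
    (λ x y sub → ≤R⇒≼ (Equivalence.from (order x y) sub))

-- Signed permutations

absolutes : ∀ {n} → Vec ℤ n → List ℕ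
absolutes p = List.map ∣_∣ (toList p)

-- The sign of the entry 0 is immaterial, so there are 2^{n-1} n! of these, one for each element of W(D_n).
SignedPermutation : ∀ {n} → Vec ℤ n → Set
SignedPermutation {n} p = absolutes p ↭ downFrom n

ρ-signed : ∀ n → SignedPermutation (ρ n)
ρ-signed zero    = ↭-refl
ρ-signed (suc n) = ↭.prep n (ρ-signed n)

absolutes-act : ∀ {n} (t : Gen (2 + n)) p → absolutes (act t p) ↭ absolutes p
absolutes-act         (s zero)    (a ∷ b ∷ p)  = ↭.swap ∣ b ∣ ∣ a ∣ ↭-refl
absolutes-act {suc n} (s (suc i)) (a ∷ p)      = ↭.prep ∣ a ∣ (absolutes-act (s i) p)
absolutes-act {zero}  s′          (a ∷ b ∷ []) rewrite ℤₚ.∣-i∣≡∣i∣ a | ℤₚ.∣-i∣≡∣i∣ b =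
  ↭.swap ∣ b ∣ ∣ a ∣ ↭-refl
absolutes-act {suc n} s′          (a ∷ p)      = ↭.prep ∣ a ∣ (absolutes-act s′ p)

signed-act : ∀ {n} (t : Gen (2 + n)) {p} → SignedPermutation p → SignedPermutation (act t p)
signed-act t {p} h = ↭-trans (absolutes-act t p) h

signed-point : ∀ {n} (w : Word (2 + n)) → SignedPermutation (point w)
signed-point {n} []  = ρ-signed (2 + n)
signed-point (t ∷ w) = signed-act t (signed-point w)

signed : Bool → ℕ → ℤ
signed true  n = + suc n
signed false n = -[1+ n ]

∣signed∣ : ∀ b n → ∣ signed b n ∣ ≡ suc n
∣signed∣ true  n = refl
∣signed∣ false n = refl

signed-injective : ∀ b c n → signed b n ≡ signed c n → b ≡ c
signed-injective true  true  n e = refl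
signed-injective false false n e = refl

signed-surjective : ∀ {n} a → ∣ a ∣ ≡ suc n → Σ Bool λ b → signed b n ≡ a
signed-surjective (+ _)    refl = true  , refl
signed-surjective -[1+ _ ] refl = false , refl

-- A record of successive insertions: starting from the vector (0), the entries 1, ..., n are
-- inserted one by one, each at any place and with either sign. The entry 0 carries no sign, which
-- accounts for the exponent n - 1 in the order of the group.
Code : ℕ → Set
Code zero    = Unit
Code (suc n) = (Fin (2 + n) × Bool) × Code n

decode : ∀ n → Code n → Vec ℤ (suc n)
decode zero    _             = 0ℤ ∷ []
decode (suc n) ((i , b) , c) = insertAt (decode n c) i (signed b n)

absolutes-insertAt : ∀ {n} (p : Vec ℤ n) i a → absolutes (insertAt p i a) ↭ ∣ a ∣ ∷ absolutes p
absolutes-insertAt p       zero    a = ↭-refl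
absolutes-insertAt (x ∷ p) (suc i) a =
  ↭-trans (↭.prep ∣ x ∣ (absolutes-insertAt p i a)) (↭.swap ∣ x ∣ ∣ a ∣ ↭-refl)

decode-signed : ∀ n (c : Code n) → SignedPermutation (decode n c)
decode-signed zero    c             = ↭-refl
decode-signed (suc n) ((i , b) , c) =
  ↭-trans (absolutes-insertAt (decode n c) i (signed b n))
          (subst (λ a → a ∷ _ ↭ _) (sym (∣signed∣ b n)) (↭.prep (suc n) (decode-signed n c)))

-- The predicate `P` singles out the inserted entry, so its position can be recovered. It is applied
-- to the entry of largest absolute value.
insertAt-injective : ∀ {A : Set} {P : A → Set} {n} (xs ys : Vec A n) i j {a b} → P a → P b →
                     All (¬_ ∘ P) (toList xs) → All (¬_ ∘ P) (toList ys) →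
                     insertAt xs i a ≡ insertAt ys j b → i ≡ j × a ≡ b × xs ≡ ys
insertAt-injective xs       ys       zero    zero    Pa Pb _        _        e with Vecₚ.∷-injective e
... | refl , refl = refl , refl , refl
insertAt-injective xs       (y ∷ ys) zero    (suc j) Pa Pb _        (¬y ∷ _) e with Vecₚ.∷-injective e
... | refl , _ = contradiction Pa ¬y
insertAt-injective (x ∷ xs) ys       (suc i) zero    Pa Pb (¬x ∷ _) _        e with Vecₚ.∷-injective e
... | refl , _ = contradiction Pb ¬x
insertAt-injective (x ∷ xs) (y ∷ ys) (suc i) (suc j) Pa Pb (_ ∷ X)  (_ ∷ Y)  e with Vecₚ.∷-injective e
... | refl , e′ with insertAt-injective xs ys i j Pa Pb X Y e′
...   | refl , refl , refl = refl , refl , refl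

decode-bounded : ∀ n (c : Code n) → All (λ a → ¬ (∣ a ∣ ≡ suc n)) (toList (decode n c))
decode-bounded n c = Allₚ.map⁻ (All.tabulate λ {x} x∈ x≡ →
  ℕₚ.<⇒≢ (∈-downFrom⁻ (∈-resp-↭ (decode-signed n c) x∈)) x≡)

decode-injective : ∀ n {c d : Code n} → decode n c ≡ decode n d → c ≡ d
decode-injective zero    e = refl
decode-injective (suc n) {(i , b) , c} {(j , b′) , d} e
  with insertAt-injective {P = λ a → ∣ a ∣ ≡ suc n} (decode n c) (decode n d) i j
         (∣signed∣ b n) (∣signed∣ b′ n) (decode-bounded n c) (decode-bounded n d) e
... | refl , e₁ , e₂ with signed-injective b b′ n e₁ | decode-injective n e₂
...   | refl | refl = refl

∈-absolutes : ∀ {n} (p : Vec ℤ n) {x} → x ∈ absolutes p → Σ (Fin n) λ i → ∣ lookup p i ∣ ≡ x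
∈-absolutes (a ∷ p) (here e)   = zero , sym e
∈-absolutes (a ∷ p) (there x∈) with ∈-absolutes p x∈
... | i , e = suc i , e

decode-surjective : ∀ n (p : Vec ℤ (suc n)) → SignedPermutation p → Σ (Code n) λ c → decode n c ≡ p
decode-surjective zero    (a ∷ []) h = tt , cong (_∷ []) (sym (ℤₚ.∣i∣≡0⇒i≡0 (Listₚ.∷-injectiveˡ (↭-singleton-inv h))))
decode-surjective (suc n) p        h with ∈-absolutes p (∈-resp-↭ (↭-sym h) (here refl))
... | i , e with signed-surjective (lookup p i) e
...   | b , e′ with decode-surjective n (removeAt p i)
                      (drop-∷ (↭-trans (↭-sym (subst₂ (λ q a → absolutes q ↭ a ∷ absolutes (removeAt p i))
                                 (Vecₚ.insertAt-removeAt p i) e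
                                 (absolutes-insertAt (removeAt p i) i (lookup p i)))) h))
...     | c , e″ = ((i , b) , c) , trans (cong₂ (λ q a → insertAt q i a) e″ e′) (Vecₚ.insertAt-removeAt p i)

-- Transitivity of the action on signed permutations

Reachable : ∀ {n} → Vec ℤ (2 + n) → Vec ℤ (2 + n) → Set
Reachable {n} p q = Σ (Word (2 + n)) λ w → actW w p ≡ q

infixr 5 _⨾_
_⨾_ : ∀ {n} {p q r : Vec ℤ (2 + n)} → Reachable p q → Reachable q r → Reachable p r
_⨾_ {p = p} (w , refl) (v , refl) = v ++ w , actW-++ v w p

step : ∀ {n} (t : Gen (2 + n)) {p} → Reachable p (act t p)
step t = [ t ] , refl

actW-↑ : ∀ {n} (w : Word (2 + n)) a p → actW (List.map ↑_ w) (a ∷ p) ≡ a ∷ actW w p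
actW-↑ []      a p = refl
actW-↑ (t ∷ w) a p = trans (cong (act (↑ t)) (actW-↑ w a p)) (act-↑ t a (actW w p))

reachable-∷ : ∀ {n} a {p q : Vec ℤ (2 + n)} → Reachable p q → Reachable (a ∷ p) (a ∷ q)
reachable-∷ a {p} (w , refl) = List.map ↑_ w , actW-↑ w a p

reachable-insertAt : ∀ {n} (a : ℤ) (p : Vec ℤ (suc n)) i → Reachable (a ∷ p) (insertAt p i a)
reachable-insertAt a p              zero       = [] , refl
reachable-insertAt a (b ∷ [])       (suc zero) = step (s zero)
reachable-insertAt a (b ∷ p@(_ ∷ _)) (suc i)   = step (s zero) ⨾ reachable-∷ b (reachable-insertAt a p i)

negateLast : ∀ {n} → Vec ℤ (suc n) → Vec ℤ (suc n)
negateLast (a ∷ [])        = - a ∷ []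
negateLast (a ∷ p@(_ ∷ _)) = a ∷ negateLast p

absolutes-negateLast : ∀ {n} (p : Vec ℤ (suc n)) → absolutes (negateLast p) ≡ absolutes p
absolutes-negateLast (a ∷ [])        = cong [_] (ℤₚ.∣-i∣≡∣i∣ a)
absolutes-negateLast (a ∷ p@(_ ∷ _)) = cong (∣ a ∣ ∷_) (absolutes-negateLast p)

-- s′ changes signs in pairs, so the sign of the moving entry is traded for that of the last one.
reachable-negate : ∀ {n} (a : ℤ) (p : Vec ℤ (suc n)) → Reachable (a ∷ negateLast p) (- a ∷ p)
reachable-negate a (b ∷ [])        = s zero ∷ s′ ∷ [] , cong (λ c → - a ∷ c ∷ []) (ℤₚ.neg-involutive b)
reachable-negate a (b ∷ p@(_ ∷ _)) =
  step (s zero) ⨾ reachable-∷ b (reachable-negate a p) ⨾ step (s zero)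

-- The leading entry of ρ waits in front while the tail is arranged, and is then moved into place.
-- For a negative sign the tail is first brought to its target with the last entry negated; changing
-- the signs of the leading and the last entry together then corrects both.
reachable-decode : ∀ n (c : Code (suc n)) → Reachable (ρ (2 + n)) (decode (suc n) c)
reachable-tail   : ∀ n (c : Code n) a → Reachable (a ∷ ρ (suc n)) (a ∷ decode n c)

reachable-decode n ((i , true)  , c) =
  reachable-tail n c (+ suc n) ⨾ reachable-insertAt (+ suc n) (decode n c) i
reachable-decode n ((i , false) , c)
  with decode-surjective n (negateLast (decode n c))
         (subst (_↭ _) (sym (absolutes-negateLast (decode n c))) (decode-signed n c))
... | d , e =
  reachable-tail n d (+ suc n)
  ⨾ subst (λ q → Reachable (_ ∷ q) (-[1+ n ] ∷ decode n c)) (sym e) (reachable-negate (+ suc n) (decode n c))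
  ⨾ reachable-insertAt -[1+ n ] (decode n c) i

-- Here the tail is the single entry 0 and there is nothing to arrange.
reachable-tail zero    c a = [] , refl
reachable-tail (suc n) c a = reachable-∷ a (reachable-decode n c)

opaque
  point-surjective : ∀ {n} (p : Vec ℤ (2 + n)) → SignedPermutation p → Reachable (ρ (2 + n)) p
  point-surjective {n} p h with decode-surjective (suc n) p h
  ... | c , refl = reachable-decode n c

-- Counting

length-cartesianProduct : ∀ {A B : Set} (xs : List A) (ys : List B) →
                          length (cartesianProduct xs ys) ≡ length xs * length ys
length-cartesianProduct []       ys = refl
length-cartesianProduct (x ∷ xs) ys = trans (Listₚ.length-++ (List.map (x ,_) ys))
  (cong₂ _+_ (Listₚ.length-map (x ,_) ys) (length-cartesianProduct xs ys))

codes : ∀ n → List (Code n)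
codes zero    = [ tt ]
codes (suc n) = cartesianProduct (cartesianProduct (allFin (2 + n)) (true ∷ false ∷ [])) (codes n)

∈-codes : ∀ n (c : Code n) → c ∈ codes n
∈-codes zero    c             = here refl
∈-codes (suc n) ((i , b) , c) = ∈-cartesianProduct⁺ (∈-cartesianProduct⁺ (∈-allFin i) (∈-Bool b)) (∈-codes n c)
  where
  ∈-Bool : ∀ b → b ∈ true ∷ false ∷ []
  ∈-Bool true  = here refl
  ∈-Bool false = there (here refl)

codes-unique : ∀ n → Unique (codes n)
codes-unique zero    = [] ∷ []
codes-unique (suc n) = Uniqueₚ.cartesianProduct⁺
  (Uniqueₚ.cartesianProduct⁺ (Uniqueₚ.allFin⁺ (2 + n)) (((λ ()) ∷ []) ∷ [] ∷ [])) (codes-unique n)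

length-codes : ∀ n → length (codes n) * 2 ≡ 2 ^ suc n * (suc n) !
length-codes zero    = refl
length-codes (suc n) = begin
  length (codes (suc n)) * 2                   ≡⟨ cong (_* 2) (length-cartesianProduct places (codes n)) ⟩
  length places * length (codes n) * 2         ≡⟨ cong (λ x → x * length (codes n) * 2) size ⟩
  (2 + n) * 2 * length (codes n) * 2           ≡⟨ regroup (2 + n) (length (codes n)) ⟩
  2 * (2 + n) * (length (codes n) * 2)         ≡⟨ cong (2 * (2 + n) *_) (length-codes n) ⟩
  2 * (2 + n) * (2 ^ suc n * (suc n) !)        ≡⟨ regroup′ (2 + n) (2 ^ suc n) ((suc n) !) ⟩
  2 ^ (2 + n) * (2 + n) !                      ∎
  where
  open ≡-Reasoning
  places = cartesianProduct (allFin (2 + n)) (true ∷ false ∷ [])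
  size : length places ≡ (2 + n) * 2
  size = trans (length-cartesianProduct (allFin (2 + n)) (true ∷ false ∷ []))
               (cong (_* 2) (Listₚ.length-tabulate {n = 2 + n} (λ i → i)))
  regroup : ∀ x y → x * 2 * y * 2 ≡ 2 * x * (y * 2)
  regroup = solveℕ-∀
  regroup′ : ∀ x y z → 2 * x * (y * z) ≡ 2 * y * (x * z)
  regroup′ = solveℕ-∀

points : ∀ n → List (Vec ℤ (2 + n))
points n = List.map (decode (suc n)) (codes (suc n))

points-unique : ∀ n → Unique (points n)
points-unique n = Uniqueₚ.map⁺ (decode-injective (suc n)) (codes-unique (suc n))

∈-points⁺ : ∀ {n} {p : Vec ℤ (2 + n)} → SignedPermutation p → p ∈ points n
∈-points⁺ {n} {p} h with decode-surjective (suc n) p h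
... | c , refl = ∈-map⁺ (decode (suc n)) (∈-codes (suc n) c)

∈-points⁻ : ∀ {n} {p : Vec ℤ (2 + n)} → p ∈ points n → SignedPermutation p
∈-points⁻ {n} p∈ with ∈-map⁻ (decode (suc n)) p∈
... | c , _ , refl = decode-signed (suc n) c

points-act : ∀ {n} (t : Gen (2 + n)) → List.map (act t) (points n) ↭ points n
points-act {n} t = ∼bag⇒↭ (unique∧set⇒bag
  (Uniqueₚ.map⁺ act-injective (points-unique n)) (points-unique n) (mk⇔ to from))
  where
  act-injective : ∀ {p q} → act t p ≡ act t q → p ≡ q
  act-injective {p} {q} e = trans (sym (act-involutive t p)) (trans (cong (act t) e) (act-involutive t q))
  to : ∀ {p} → p ∈ List.map (act t) (points n) → p ∈ points n
  to p∈ with ∈-map⁻ (act t) p∈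
  ... | q , q∈ , refl = ∈-points⁺ (signed-act t (∈-points⁻ q∈))
  from : ∀ {p} → p ∈ points n → p ∈ List.map (act t) (points n)
  from {p} p∈ = subst (_∈ _) (act-involutive t p) (∈-map⁺ (act t) (∈-points⁺ (signed-act t (∈-points⁻ p∈))))

length-filter-split : ∀ {A : Set} {P Q R : A → Set} (P? : Decidable P) (Q? : Decidable Q) (R? : Decidable R) xs →
                      All (λ x → P x → Q x ⊎ R x) xs → (∀ {x} → Q x → P x) → (∀ {x} → R x → P x) →
                      (∀ {x} → Q x → ¬ R x) →
                      length (filter P? xs) ≡ length (filter Q? xs) + length (filter R? xs)
length-filter-split P? Q? R? []       _       _  _  _  = refl
length-filter-split P? Q? R? (x ∷ xs) (h ∷ H) qp rp qr
  with P? x | Q? x | R? x | length-filter-split P? Q? R? xs H qp rp qr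
... | yes p | yes q | yes r | ih = contradiction r (qr q)
... | yes p | yes q | no  _ | ih = cong suc ih
... | yes p | no  _ | yes r | ih = trans (cong suc ih) (sym (ℕₚ.+-suc _ _))
... | yes p | no ¬q | no ¬r | ih = contradiction (h p) [ ¬q , ¬r ]′
... | no ¬p | yes q | _     | ih = contradiction (qp q) ¬p
... | no ¬p | no  _ | yes r | ih = contradiction (rp r) ¬p
... | no _  | no  _ | no _  | ih = ih

length-filter-map : ∀ {A B : Set} {P : B → Set} {Q : A → Set} (P? : Decidable P) (Q? : Decidable Q) (f : A → B) →
                    (∀ x → P (f x) → Q x) → (∀ x → Q x → P (f x)) → ∀ xs →
                    length (filter P? (List.map f xs)) ≡ length (filter Q? xs)
length-filter-map P? Q? f to from []       = refl
length-filter-map P? Q? f to from (x ∷ xs) with P? (f x) | Q? x | length-filter-map P? Q? f to from xs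
... | yes _ | yes _ | ih = cong suc ih
... | no  _ | no  _ | ih = ih
... | yes p | no ¬q | ih = contradiction (to x p) ¬q
... | no ¬p | yes q | ih = contradiction (from x q) ¬p

Positive : ∀ {n} → Word (2 + n) → Vec ℤ (2 + n) → Set
Positive l p = All (λ t → 0ℤ ℤ.< form t p) l

positive? : ∀ {n} (l : Word (2 + n)) → Decidable (Positive l)
positive? l p = all? (λ t → 0ℤ ℤₚ.<? form t p) l

positive-act : ∀ {n} {t : Gen (2 + n)} {l} p → All (Commute t) l → Positive l p → Positive l (act t p)
positive-act         p []      []      = []
positive-act {t = t} {r ∷ l} p (e ∷ c) (h ∷ H) = subst (0ℤ ℤ.<_) (sym (form-act-commute t r e p)) h ∷ positive-act p c H

-- p ↦ act t p changes the sign of form t and preserves form r for every r commuting with t.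
length-positive-∷ : ∀ {n} (t : Gen (2 + n)) l → All (Commute t) l →
                    length (filter (positive? l) (points n)) ≡ length (filter (positive? (t ∷ l)) (points n)) * 2
length-positive-∷ {n} t l c = begin
  length (filter (positive? l) L)                                      ≡⟨ split ⟩
  length (filter (positive? (t ∷ l)) L) + length (filter negative? L)  ≡⟨ cong (_+_ (length (filter (positive? (t ∷ l)) L))) mirror ⟩
  x + x                                                                ≡⟨ double x ⟩
  x * 2                                                                ∎
  where
  open ≡-Reasoning
  L = points n
  x = length (filter (positive? (t ∷ l)) L)
  double : ∀ x → x + x ≡ x * 2
  double = solveℕ-∀
  Negative : Vec ℤ (2 + n) → Set
  Negative p = Positive (t ∷ l) (act t p)
  negative? : Decidable Negative
  negative? p = positive? (t ∷ l) (act t p)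
  split : length (filter (positive? l) L) ≡ x + length (filter negative? L)
  split = length-filter-split (positive? l) (positive? (t ∷ l)) negative? L
    (All.tabulate λ {p} p∈ P → dichotomy p (∈-points⁻ p∈) P)
    (λ { (_ ∷ P) → P })
    (λ { {p} (_ ∷ P) → subst (Positive l) (act-involutive t p) (positive-act (act t p) c P) })
    (λ { {p} (h ∷ _) (h′ ∷ _) → ℤₚ.<-asym (subst (0ℤ ℤ.<_) (form-act-same t p) h′) (ℤₚ.neg-mono-< h) })
    where
    -- By transitivity p lies in the orbit of ρ, so the form of t does not vanish there.
    dichotomy : ∀ p → SignedPermutation p → Positive l p → Positive (t ∷ l) p ⊎ Negative p
    dichotomy p h P with point-surjective p h
    ... | w , refl with ascent-or-descent t w
    ...   | inj₁ (ascent a) = inj₁ (a ∷ P)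
    ...   | inj₂ d with descent-flip d
    ...     | ascent a = inj₂ (a ∷ positive-act p c P)
  -- The negative half is the preimage of the positive half under `act t`, which permutes
  -- `points n`.
  mirror : length (filter negative? L) ≡ x
  mirror = trans (sym (length-filter-map (positive? (t ∷ l)) negative? (act t) (λ _ P → P) (λ _ P → P) L))
                 (↭-length (filter-↭ (positive? (t ∷ l)) (points-act t)))

length-positive : ∀ {n} (l : Word (2 + n)) → Commuting l →
                  length (filter (positive? l) (points n)) * 2 ^ length l ≡ length (points n)
length-positive {n} [] [] = trans (ℕₚ.*-identityʳ _)
  (cong length (Listₚ.filter-all (positive? []) (All.universal (λ _ → []) (points n))))
length-positive {n} (t ∷ l) (c ∷ C) = begin
  x * (2 * 2 ^ length l)   ≡⟨ ℕₚ.*-assoc x 2 _ ⟨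
  x * 2 * 2 ^ length l     ≡⟨ cong (_* 2 ^ length l) (length-positive-∷ t l c) ⟨
  length (filter (positive? l) (points n)) * 2 ^ length l ≡⟨ length-positive l C ⟩
  length (points n)        ∎
  where
  open ≡-Reasoning
  x = length (filter (positive? (t ∷ l)) (points n))

-- Independent sets of the Coxeter graph

commuting-↑ : ∀ {n} (l : Word (2 + n)) → Commuting l → Commuting (List.map ↑_ l)
commuting-↑ []      []      = []
commuting-↑ (t ∷ l) (c ∷ C) = Allₚ.map⁺ (All.map (λ {r} e → trans (m-↑ t r) e) c) ∷ commuting-↑ l C

commuting-↑⁻ : ∀ {n} (l : Word (2 + n)) → Commuting (List.map ↑_ l) → Commuting l
commuting-↑⁻ []      []      = []
commuting-↑⁻ (t ∷ l) (c ∷ C) = All.map (λ {r} e → trans (sym (m-↑ t r)) e) (Allₚ.map⁻ c) ∷ commuting-↑⁻ l C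

first-commutes : ∀ {n} (t : Gen (2 + n)) → Commute (s zero) (↑ ↑ t)
first-commutes (s i) = refl
first-commutes s′    = refl

commutes-first : ∀ {n} (r : Gen (4 + n)) → Commute (s zero) r → Σ (Gen (2 + n)) λ t → r ≡ ↑ ↑ t
commutes-first (s (suc (suc i))) e = s i , refl
commutes-first s′                e = s′ , refl

lower-one : ∀ {n} (l : Word (3 + n)) → s zero ∉ l → Σ (Word (2 + n)) λ k → l ≡ List.map ↑_ k
lower-one []              _  = [] , refl
lower-one (s zero ∷ l)    t∉ = contradiction (here refl) t∉
lower-one (s (suc i) ∷ l) t∉ with lower-one l (t∉ ∘ there)
... | k , refl = s i ∷ k , refl
lower-one (s′ ∷ l)        t∉ with lower-one l (t∉ ∘ there)
... | k , refl = s′ ∷ k , refl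

lower-two : ∀ {n} {l : Word (4 + n)} → All (Commute (s zero)) l →
            Σ (Word (2 + n)) λ k → l ≡ List.map ↑_ (List.map ↑_ k)
lower-two {l = []}    []      = [] , refl
lower-two {l = r ∷ _} (e ∷ c) with commutes-first r e | lower-two c
... | t , refl | k , refl = t ∷ k , refl

withFirst : ∀ {n k} → Vec (Gen (2 + n)) k → Vec (Gen (4 + n)) (suc k)
withFirst J = s zero ∷ Vec.map ↑_ (Vec.map ↑_ J)

-- The graph of D_n is a path ending in a fork; the recursion splits off its far end s_1, whose only neighbour
-- is s_2 once n ≥ 4.
independent : ∀ n k → List (Vec (Gen (2 + n)) k)
independent n             zero                = [ [] ]
independent zero          (suc zero)          = (s zero ∷ []) ∷ (s′ ∷ []) ∷ []
independent zero          (suc (suc zero))    = [ s zero ∷ s′ ∷ [] ]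
independent zero          (suc (suc (suc k))) = []
independent (suc zero)    (suc zero)          = (s zero ∷ []) ∷ List.map (Vec.map ↑_) (independent zero 1)
independent (suc zero)    (suc (suc k))       = List.map (Vec.map ↑_) (independent zero (2 + k))
independent (suc (suc n)) (suc k)             =
  List.map withFirst (independent n k) ++ List.map (Vec.map ↑_) (independent (suc n) (suc k))

lift-commuting : ∀ {n k} {Js : List (Vec (Gen (2 + n)) k)} →
                 All (λ J → Commuting (toList J)) Js → All (λ J → Commuting (toList J)) (List.map (Vec.map ↑_) Js)
lift-commuting C = Allₚ.map⁺ (All.map (λ {J} c →
  subst Commuting (sym (Vecₚ.toList-map ↑_ J)) (commuting-↑ (toList J) c)) C)

toList-map² : ∀ {n k} (J : Vec (Gen (2 + n)) k) →
              toList (Vec.map ↑_ (Vec.map ↑_ J)) ≡ List.map ↑_ (List.map ↑_ (toList J))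
toList-map² J = trans (Vecₚ.toList-map ↑_ (Vec.map ↑_ J)) (cong (List.map ↑_) (Vecₚ.toList-map ↑_ J))

withFirst-commuting : ∀ {n k} (J : Vec (Gen (2 + n)) k) → Commuting (toList J) → Commuting (toList (withFirst J))
withFirst-commuting J c rewrite toList-map² J =
  Allₚ.map⁺ (Allₚ.map⁺ (All.universal first-commutes (toList J))) ∷ commuting-↑ _ (commuting-↑ _ c)

independent-commuting : ∀ n k → All (λ J → Commuting (toList J)) (independent n k)
independent-commuting zero          zero                = [] ∷ []
independent-commuting (suc n)       zero                = [] ∷ []
independent-commuting zero          (suc zero)          = ([] ∷ []) ∷ ([] ∷ []) ∷ []
independent-commuting zero          (suc (suc zero))    = ((refl ∷ []) ∷ [] ∷ []) ∷ []
independent-commuting zero          (suc (suc (suc k))) = []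
independent-commuting (suc zero)    (suc zero)          = ([] ∷ []) ∷ lift-commuting (independent-commuting zero 1)
independent-commuting (suc zero)    (suc (suc k))       = lift-commuting (independent-commuting zero (2 + k))
independent-commuting (suc (suc n)) (suc k)             = Allₚ.++⁺
  (Allₚ.map⁺ (All.map (λ {J} → withFirst-commuting J) (independent-commuting n k)))
  (lift-commuting (independent-commuting (suc n) (suc k)))

Listed : ∀ {n} → ℕ → Word (2 + n) → Set
Listed {n} k l = Σ (Vec (Gen (2 + n)) k) λ J → J ∈ independent n k × toList J ↭ l

private
  lift-↭ : ∀ {n k} (J : Vec (Gen (2 + n)) k) {l} → toList J ↭ l → toList (Vec.map ↑_ J) ↭ List.map ↑_ l
  lift-↭ J {l} p = subst (_↭ List.map ↑_ l) (sym (Vecₚ.toList-map ↑_ J)) (↭ₚ.map⁺ ↑_ p)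

  listed₀ : ∀ (l : Word 2) → Commuting l → Listed {0} (length l) l
  listed₀ []                       C = [] , here refl , ↭-refl
  listed₀ (s zero ∷ [])            C = _ , here refl , ↭-refl
  listed₀ (s′ ∷ [])                C = _ , there (here refl) , ↭-refl
  listed₀ (s zero ∷ s′ ∷ [])       C = _ , here refl , ↭-refl
  listed₀ (s′ ∷ s zero ∷ [])       C = _ , here refl , ↭.swap (s zero) s′ ↭-refl
  listed₀ (s zero ∷ s zero ∷ _)    ((() ∷ _) ∷ _)
  listed₀ (s′ ∷ s′ ∷ _)            ((() ∷ _) ∷ _)
  listed₀ (s zero ∷ s′ ∷ s zero ∷ _) ((_ ∷ () ∷ _) ∷ _)
  listed₀ (s zero ∷ s′ ∷ s′ ∷ _)     (_ ∷ (() ∷ _) ∷ _)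
  listed₀ (s′ ∷ s zero ∷ s zero ∷ _) (_ ∷ (() ∷ _) ∷ _)
  listed₀ (s′ ∷ s zero ∷ s′ ∷ _)     ((_ ∷ () ∷ _) ∷ _)

  listed-lift : ∀ {n} k l → (∀ {J} → J ∈ independent n k → Vec.map ↑_ J ∈ independent (suc n) k) →
                Listed {n} k l → Listed {suc n} k (List.map ↑_ l)
  listed-lift k l inc (J , J∈ , p) = Vec.map ↑_ J , inc J∈ , lift-↭ J p

  listed-first : ∀ {n} k (l : Word (2 + n)) → Listed {n} k l →
                 Listed {2 + n} (suc k) (s zero ∷ List.map ↑_ (List.map ↑_ l))
  listed-first k l (J , J∈ , p) =
    withFirst J , ∈-++⁺ˡ (∈-map⁺ withFirst J∈) , ↭.prep (s zero) (lift-↭ (Vec.map ↑_ J) (lift-↭ J p))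

  lift-∈ : ∀ n k {J} → J ∈ independent n k → Vec.map ↑_ J ∈ independent (suc n) k
  lift-∈ n       zero          {[]} J∈ = here refl
  lift-∈ zero    (suc zero)    J∈ = there (∈-map⁺ (Vec.map ↑_) J∈)
  lift-∈ zero    (suc (suc k)) J∈ = ∈-map⁺ (Vec.map ↑_) J∈
  lift-∈ (suc n) (suc k)       J∈ = ∈-++⁺ʳ (List.map withFirst (independent n k)) (∈-map⁺ (Vec.map ↑_) J∈)

  listed-↭ : ∀ {n k} {l l′ : Word (2 + n)} → l ↭ l′ → Listed k l → Listed k l′
  listed-↭ p (J , J∈ , q) = J , J∈ , ↭-trans q p

  alone : ∀ {l : Word 3} → All (Commute (s zero)) l → l ≡ []
  alone []                                 = refl
  alone {s zero ∷ _}       (() ∷ _)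
  alone {s (suc zero) ∷ _} (() ∷ _)
  alone {s′ ∷ _}           (() ∷ _)

-- Either s_1 is absent and l comes from the smaller diagram, or it can be moved to the front and
-- the other letters all avoid its neighbours. Order is immaterial, and repetitions cannot occur
-- because no generator commutes with itself.
independent-complete : ∀ n (l : Word (2 + n)) → Commuting l → Listed {n} (length l) l
independent-complete zero    l C = listed₀ l C
independent-complete (suc n) l C with ∈? _≟_ (s zero) l
... | no  t∉ with lower-one l t∉
...   | k , refl rewrite Listₚ.length-map (↑_ {n}) k =
        listed-lift (length k) k (lift-∈ n (length k)) (independent-complete n k (commuting-↑⁻ k C))
independent-complete (suc n) l C | yes t∈ with ∈-∃++ t∈
... | a , b , refl rewrite ↭-length (shift (s zero) a b) =
      listed-↭ (↭-sym (shift (s zero) a b)) (go n (a ++ b) (commuting-↭ (shift (s zero) a b) C))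
  where
  go : ∀ n (r : Word (3 + n)) → Commuting (s zero ∷ r) → Listed {suc n} (suc (length r)) (s zero ∷ r)
  go zero r (c ∷ _) with alone c
  ... | refl = _ , here refl , ↭-refl
  go (suc n) r (c ∷ C) with lower-two c
  ... | k , refl rewrite Listₚ.length-map (↑_ {suc n}) (List.map (↑_ {n}) k) | Listₚ.length-map (↑_ {n}) k =
        listed-first (length k) k (independent-complete n k (commuting-↑⁻ k (commuting-↑⁻ (List.map ↑_ k) C)))

key : ∀ {n k} → Vec (Gen (2 + n)) k → Vec ℤ (2 + n)
key J = point (toList J)

key-lift : ∀ {n k} (J : Vec (Gen (2 + n)) k) → key (Vec.map ↑_ J) ≡ + (2 + n) ∷ key J
key-lift {n} J = trans (cong point (Vecₚ.toList-map ↑_ J)) (actW-↑ (toList J) (+ (2 + n)) (ρ (2 + n)))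

key-withFirst : ∀ {n k} (J : Vec (Gen (2 + n)) k) → key (withFirst J) ≡ + (2 + n) ∷ + (3 + n) ∷ key J
key-withFirst {n} J = cong (act (s zero)) (trans (key-lift (Vec.map ↑_ J)) (cong (+ (3 + n) ∷_) (key-lift J)))

-- Lists of distinct keys keep apart not only the sets but also the group elements that they represent.
KeysUnique : ∀ {n k} → List (Vec (Gen (2 + n)) k) → Set
KeysUnique Js = AllPairs (λ J K → key J ≢ key K) Js

private
  keys-lift : ∀ {n k} {Js : List (Vec (Gen (2 + n)) k)} → KeysUnique Js → KeysUnique (List.map (Vec.map ↑_) Js)
  keys-lift U = AllPairsₚ.map⁺ (AllPairs.map (λ {J} {K} ≢ e →
    ≢ (Vecₚ.∷-injectiveʳ (trans (sym (key-lift J)) (trans e (key-lift K))))) U)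

  keys-withFirst : ∀ {n k} {Js : List (Vec (Gen (2 + n)) k)} → KeysUnique Js → KeysUnique (List.map withFirst Js)
  keys-withFirst U = AllPairsₚ.map⁺ (AllPairs.map (λ {J} {K} ≢ e →
    ≢ (Vecₚ.∷-injectiveʳ (Vecₚ.∷-injectiveʳ (trans (sym (key-withFirst J)) (trans e (key-withFirst K)))))) U)

independent-keys : ∀ n k → KeysUnique (independent n k)
independent-keys zero          zero                = [] ∷ []
independent-keys (suc n)       zero                = [] ∷ []
independent-keys zero          (suc zero)          = ((λ ()) ∷ []) ∷ [] ∷ []
independent-keys zero          (suc (suc zero))    = [] ∷ []
independent-keys zero          (suc (suc (suc k))) = []
independent-keys (suc zero)    (suc zero)          = ((λ ()) ∷ (λ ()) ∷ []) ∷ keys-lift (independent-keys zero 1)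
independent-keys (suc zero)    (suc (suc k))       = keys-lift (independent-keys zero (2 + k))
independent-keys (suc (suc n)) (suc k)             = AllPairsₚ.++⁺
  (keys-withFirst (independent-keys n k)) (keys-lift (independent-keys (suc n) (suc k)))
  (Allₚ.map⁺ (All.universal (λ J → Allₚ.map⁺ (All.universal (λ K e →
    heads (Vecₚ.∷-injectiveˡ (trans (sym (key-withFirst J)) (trans e (key-lift K))))) _)) _))
  where
  -- The leading coordinate of the key tells whether s_1 belongs to the set: s_1 exchanges the first
  -- two entries of ρ, while lifted generators leave the first one in place.
  heads : + (2 + n) ≢ + (3 + n)
  heads e = ℕₚ.1+n≢n (sym (ℤₚ.+-injective e))

independent-unique : ∀ n k → Unique (independent n k)
independent-unique n k = AllPairs.map (λ ≢ e → ≢ (cong key e)) (independent-keys n k)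

key-injective : ∀ {n k} {J K : Vec (Gen (2 + n)) k} → J ∈ independent n k → K ∈ independent n k → key J ≡ key K → J ≡ K
key-injective {n} {k} J∈ K∈ e with ∈-AllPairs₂ (independent-keys n k) J∈ K∈
... | inj₁ eq        = eq
... | inj₂ (inj₁ ≢)  = contradiction e ≢
... | inj₂ (inj₂ ≢)  = contradiction (sym e) ≢

-- Enumeration of the Boolean intervals

-- With binomials vanishing for negative upper argument, the rule fails only at a = -1, b = 0, where
-- the left side is 1 and the right side 0.
pascal : ∀ a b → (a ≡ -[1+ 0 ] → b ≢ + 0) → binomℤ (+ 1 ℤ.+ a) b ≡ binomℤ a (b - + 1) + binomℤ a b
pascal (+ a)          (+ zero)      h = refl
pascal (+ a)          (+ (suc b))   h = sym (nCk+nC[k+1]≡[n+1]C[k+1] a b)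
pascal (+ a)          -[1+ b ]      h = refl
pascal -[1+ zero ]    (+ zero)      h = contradiction refl (h refl)
pascal -[1+ zero ]    (+ (suc b))   h = refl
pascal -[1+ zero ]    -[1+ b ]      h = refl
pascal -[1+ suc a ]   b             h = refl

count : ℕ → ℕ → ℕ
count n k = binomℤ (+ n - + k) (+ k - + 2) + binomℤ (+ n - + k - + 1) (+ k - + 1) + binomℤ (+ n - + k) (+ k)

count-suc : ∀ n k → count (4 + n) (suc k) ≡ count (2 + n) k + count (3 + n) (suc k)
count-suc n k = begin
  binomℤ (+ (4 + n) - + suc k) (+ suc k - + 2) + binomℤ (+ (4 + n) - + suc k - + 1) (+ suc k - + 1) + binomℤ (+ (4 + n) - + suc k) (+ suc k)
    ≡⟨ cong₂ _+_ (cong₂ _+_ first second) third ⟩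
  (x₁ + y₁) + (x₂ + y₂) + (x₃ + y₃)
    ≡⟨ regroup x₁ y₁ x₂ y₂ x₃ y₃ ⟩
  count (2 + n) k + count (3 + n) (suc k) ∎
  where
  open ≡-Reasoning
  x₁ = binomℤ (+ (2 + n) - + k) (+ k - + 2)
  x₂ = binomℤ (+ (2 + n) - + k - + 1) (+ k - + 1)
  x₃ = binomℤ (+ (2 + n) - + k) (+ k)
  y₁ = binomℤ (+ (3 + n) - + suc k) (+ suc k - + 2)
  y₂ = binomℤ (+ (3 + n) - + suc k - + 1) (+ suc k - + 1)
  y₃ = binomℤ (+ (3 + n) - + suc k) (+ suc k)
  regroup : ∀ a b c d e f → (a + b) + (c + d) + (e + f) ≡ (a + c + e) + (b + d + f)
  regroup = solveℕ-∀
  N = + n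
  K = + k
  step-by : ∀ {a b a₀ a₁ b₁} → a ≡ + 1 ℤ.+ a₀ → a₀ ≡ a₁ → b - + 1 ≡ b₁ → (a₀ ≡ -[1+ 0 ] → b ≢ + 0) →
            binomℤ a b ≡ binomℤ a₁ b₁ + binomℤ a₀ b
  step-by {b = b} {a₀ = a₀} refl refl refl h = pascal a₀ b h
  e₁ : ∀ N K → (+ 4 ℤ.+ N) - (+ 1 ℤ.+ K) ≡ + 1 ℤ.+ ((+ 3 ℤ.+ N) - (+ 1 ℤ.+ K))
  e₁ = solve-∀
  e₂ : ∀ N K → (+ 3 ℤ.+ N) - (+ 1 ℤ.+ K) ≡ (+ 2 ℤ.+ N) - K
  e₂ = solve-∀
  e₃ : ∀ K → ((+ 1 ℤ.+ K) - + 2) - + 1 ≡ K - + 2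
  e₃ = solve-∀
  e₄ : ∀ N K → (+ 4 ℤ.+ N) - (+ 1 ℤ.+ K) - + 1 ≡ + 1 ℤ.+ ((+ 3 ℤ.+ N) - (+ 1 ℤ.+ K) - + 1)
  e₄ = solve-∀
  e₅ : ∀ K → ((+ 1 ℤ.+ K) - + 1) - + 1 ≡ K - + 1
  e₅ = solve-∀
  e₆ : ∀ K → (+ 1 ℤ.+ K) - + 1 ≡ K
  e₆ = solve-∀
  e₇ : ∀ N K → (((+ 3 ℤ.+ N) - (+ 1 ℤ.+ K)) ℤ.+ ((+ 1 ℤ.+ K) - + 2)) - + 1 ≡ N
  e₇ = solve-∀
  e₈ : ∀ N K → (((+ 3 ℤ.+ N) - (+ 1 ℤ.+ K) - + 1) ℤ.+ ((+ 1 ℤ.+ K) - + 1)) - + 1 ≡ N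
  e₈ = solve-∀
  -- The exceptional pair would give a + b - 1 = -2, whereas in the first two terms this sum is n,
  -- which is not negative.
  impossible : ∀ {a b} → (a ℤ.+ b) - + 1 ≡ N → a ≡ -[1+ 0 ] → b ≢ + 0
  impossible e refl refl with e
  ... | ()
  first : binomℤ (+ (4 + n) - + suc k) (+ suc k - + 2) ≡ x₁ + y₁
  first = step-by {b = + suc k - + 2} (e₁ N K) (e₂ N K) (e₃ K) (impossible (e₇ N K))
  second : binomℤ (+ (4 + n) - + suc k - + 1) (+ suc k - + 1) ≡ x₂ + y₂
  second = step-by {b = + suc k - + 1} (e₄ N K) (cong (_- + 1) (e₂ N K)) (e₅ K) (impossible (e₈ N K))
  third : binomℤ (+ (4 + n) - + suc k) (+ suc k) ≡ x₃ + y₃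
  third = step-by {b = + suc k} (e₁ N K) (e₂ N K) (e₆ K) λ _ ()

length-independent : ∀ n k → length (independent n k) ≡ count (2 + n) k
length-independent zero          zero                = refl
length-independent (suc n)       zero                = refl
length-independent zero          (suc zero)          = refl
length-independent zero          (suc (suc zero))    = refl
length-independent zero          (suc (suc (suc k))) = refl
length-independent (suc zero)    (suc zero)          = refl
length-independent (suc zero)    (suc (suc zero))    = refl
length-independent (suc zero)    (suc (suc (suc zero))) = refl
length-independent (suc zero)    (suc (suc (suc (suc k)))) = refl
length-independent (suc (suc n)) (suc k)             = begin
  length (List.map withFirst (independent n k) ++ List.map (Vec.map ↑_) (independent (suc n) (suc k)))
    ≡⟨ Listₚ.length-++ (List.map withFirst (independent n k)) ⟩
  length (List.map withFirst (independent n k)) + length (List.map (Vec.map ↑_) (independent (suc n) (suc k)))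
    ≡⟨ cong₂ _+_ (Listₚ.length-map withFirst (independent n k)) (Listₚ.length-map (Vec.map ↑_) (independent (suc n) (suc k))) ⟩
  length (independent n k) + length (independent (suc n) (suc k))
    ≡⟨ cong₂ _+_ (length-independent n k) (length-independent (suc n) (suc k)) ⟩
  count (2 + n) k + count (3 + n) (suc k)
    ≡⟨ count-suc n k ⟨
  count (4 + n) (suc k) ∎
  where open ≡-Reasoning

-- A pair (J, p) encodes the interval from u to u times the product of J, where p is the image of ρ
-- under the inverse of u. Positivity of the forms of J at p says that J consists of right ascents
-- of u.
Labelled : ℕ → ℕ → Set
Labelled n k = Vec (Gen (2 + n)) k × Vec ℤ (2 + n)

PositiveOn : ∀ {n k} → Labelled n k → Set
PositiveOn (J , p) = Positive (toList J) p

positiveOn? : ∀ {n k} → Decidable (PositiveOn {n} {k})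
positiveOn? (J , p) = positive? (toList J) p

opaque
  labelled : ∀ n k → List (Labelled n k)
  labelled n k = filter positiveOn? (cartesianProduct (independent n k) (points n))

  length-labelled : ∀ n k → length (labelled n k) * 2 ^ k ≡ length (independent n k) * length (points n)
  length-labelled n k = go (independent n k) (independent-commuting n k)
    where
    open ≡-Reasoning
    go : ∀ (Js : List (Vec (Gen (2 + n)) k)) → All (λ J → Commuting (toList J)) Js →
         length (filter positiveOn? (cartesianProduct Js (points n))) * 2 ^ k ≡ length Js * length (points n)
    go []       []      = refl
    go (J ∷ Js) (c ∷ C) = begin
      length (filter positiveOn? (List.map (J ,_) (points n) ++ rest)) * 2 ^ k
        ≡⟨ cong (λ l → length l * 2 ^ k) (Listₚ.filter-++ positiveOn? (List.map (J ,_) (points n)) rest) ⟩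
      length (filter positiveOn? (List.map (J ,_) (points n)) ++ filter positiveOn? rest) * 2 ^ k
        ≡⟨ cong (_* 2 ^ k) (Listₚ.length-++ (filter positiveOn? (List.map (J ,_) (points n)))) ⟩
      (length (filter positiveOn? (List.map (J ,_) (points n))) + length (filter positiveOn? rest)) * 2 ^ k
        ≡⟨ ℕₚ.*-distribʳ-+ (2 ^ k) (length (filter positiveOn? (List.map (J ,_) (points n)))) _ ⟩
      length (filter positiveOn? (List.map (J ,_) (points n))) * 2 ^ k + length (filter positiveOn? rest) * 2 ^ k
        ≡⟨ cong₂ _+_ here-part (go Js C) ⟩
      length (points n) + length Js * length (points n) ∎
      where
      rest : List (Labelled n k)
      rest = cartesianProduct Js (points n)
      here-part : length (filter positiveOn? (List.map (J ,_) (points n))) * 2 ^ k ≡ length (points n)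
      here-part = begin
        length (filter positiveOn? (List.map (J ,_) (points n))) * 2 ^ k
          ≡⟨ cong (_* 2 ^ k) (length-filter-map positiveOn? (positive? (toList J)) (J ,_) (λ _ h → h) (λ _ h → h) (points n)) ⟩
        length (filter (positive? (toList J)) (points n)) * 2 ^ k
          ≡⟨ cong (λ j → length (filter (positive? (toList J)) (points n)) * 2 ^ j) (Vecₚ.length-toList J) ⟨
        length (filter (positive? (toList J)) (points n)) * 2 ^ length (toList J)
          ≡⟨ length-positive (toList J) c ⟩
        length (points n) ∎

  labelled-unique : ∀ n k → Unique (labelled n k)
  labelled-unique n k = Uniqueₚ.filter⁺ positiveOn? (Uniqueₚ.cartesianProduct⁺ (independent-unique n k) (points-unique n))

  ∈-labelled⁺ : ∀ {n k} {J : Vec (Gen (2 + n)) k} {p} → J ∈ independent n k → SignedPermutation p →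
                Positive (toList J) p → (J , p) ∈ labelled n k
  ∈-labelled⁺ J∈ σ P = ∈-filter⁺ positiveOn? (∈-cartesianProduct⁺ J∈ (∈-points⁺ σ)) P

  ∈-labelled⁻ : ∀ {n k} {J : Vec (Gen (2 + n)) k} {p} → (J , p) ∈ labelled n k →
                J ∈ independent n k × SignedPermutation p × Positive (toList J) p
  ∈-labelled⁻ {n} {k} x∈ with ∈-filter⁻ positiveOn? {xs = cartesianProduct (independent n k) (points n)} x∈
  ... | y∈ , P with ∈-cartesianProduct⁻ (independent n k) (points n) y∈
  ...   | J∈ , p∈ = J∈ , ∈-points⁻ p∈ , P

lookup-injective : ∀ {A : Set} {xs : List A} → Unique xs → ∀ i j → List.lookup xs i ≡ List.lookup xs j → i ≡ j
lookup-injective {xs = x ∷ xs} (x∉ ∷ U) zero    zero    e = refl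
lookup-injective {xs = x ∷ xs} (x∉ ∷ U) zero    (suc j) e = contradiction e (All.lookup x∉ (∈-lookup j))
lookup-injective {xs = x ∷ xs} (x∉ ∷ U) (suc i) zero    e = contradiction (sym e) (All.lookup x∉ (∈-lookup i))
lookup-injective {xs = x ∷ xs} (x∉ ∷ U) (suc i) (suc j) e = cong suc (lookup-injective U i j e)

module _ (n k : ℕ) where

  private
    N = length (labelled n k)

    module Item {J : Vec (Gen (2 + n)) k} {p} (x∈ : (J , p) ∈ labelled n k) where
      J∈ : J ∈ independent n k
      J∈ = proj₁ (∈-labelled⁻ x∈)

      commuting : Commuting (toList J)
      commuting = All.lookup (independent-commuting n k) J∈

      reach : Reachable (ρ (2 + n)) p
      reach = point-surjective p (proj₁ (proj₂ (∈-labelled⁻ x∈)))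

      bottom : Word (2 + n)
      bottom = inv (proj₁ reach)

      point-bottom : point (inv bottom) ≡ p
      point-bottom = trans (cong point (Listₚ.reverse-involutive (proj₁ reach))) (proj₂ reach)

      ascents : Ascents bottom (toList J)
      ascents = All.map (λ {t} h → ascent (subst (λ q → 0ℤ ℤ.< form t q) (sym point-bottom) h))
                        (proj₂ (proj₂ (∈-labelled⁻ x∈)))

      interval : BoolInt (2 + n) k
      interval = (bottom , bottom ++ toList J) , commuting⇒boolean J commuting ascents

    item : ∀ i → List.lookup (labelled n k) i ∈ labelled n k
    item i = ∈-lookup i

    -- The bottom determines p. Cancelling it from the top leaves the product of J, whose key
    -- determines J within the list.
    distinct : ∀ {J K : Vec (Gen (2 + n)) k} {p q} (x∈ : (J , p) ∈ labelled n k) (y∈ : (K , q) ∈ labelled n k) →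
               Item.bottom x∈ ≈ Item.bottom y∈ →
               (Item.bottom x∈ ++ toList J) ≈ (Item.bottom y∈ ++ toList K) → (J , p) ≡ (K , q)
    distinct {J} {K} x∈ y∈ e e′ = cong₂ _,_
      (key-injective (Item.J∈ x∈) (Item.J∈ y∈)
        (point-≈ (++-cancelˡ (Item.bottom x∈) (e′ ∙ ++-congʳ (toList K) (≈-sym e)))))
      (trans (sym (Item.point-bottom x∈)) (trans (point-≈ (inv-cong e)) (Item.point-bottom y∈)))

    -- The word that `point-surjective` supplies for p need not be `inv u`; faithfulness on the
    -- orbit identifies the two.
    bottom-≈ : ∀ {J p} (x∈ : (J , p) ∈ labelled n k) {u} → point (inv u) ≡ p → Item.bottom x∈ ≈ u
    bottom-≈ x∈ {u} e =
      inv-cong {u = proj₁ (Item.reach x∈)} {v = inv u} (point-injective (trans (proj₂ (Item.reach x∈)) (sym e))) ∙ ≈-reflexive (Listₚ.reverse-involutive u)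

    find : ∀ {u w} → CommutingLabels k u w → Σ (Fin N) λ i →
           (Item.bottom (item i) ≈ u) × ((Item.bottom (item i) ++ toList (proj₁ (List.lookup (labelled n k) i))) ≈ w)
    find {u} {w} L = match (subst (λ j → Listed {n} j l) size (independent-complete n l commuting))
      where
      open CommutingLabels L renaming (labels to l)
      match : Listed {n} k l → Σ (Fin N) λ i →
              (Item.bottom (item i) ≈ u) × ((Item.bottom (item i) ++ toList (proj₁ (List.lookup (labelled n k) i))) ≈ w)
      match (J , J∈ , p) = index x∈ , transport (item (index x∈)) (sym (lookup-index x∈))
        where
        x∈ : (J , point (inv u)) ∈ labelled n k
        x∈ = ∈-labelled⁺ J∈ (signed-point (inv u))
               (All-resp-↭ (↭-sym p) (All.map (λ { (ascent a) → a }) ascents))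
        -- The entry found by lookup is only propositionally equal to the pair sought; abstracting
        -- it as `y` allows the equation to be matched.
        transport : ∀ {y} (y∈ : y ∈ labelled n k) → y ≡ (J , point (inv u)) →
                    (Item.bottom y∈ ≈ u) × ((Item.bottom y∈ ++ toList (proj₁ y)) ≈ w)
        transport y∈ refl = bottom-≈ y∈ refl
          , (++-cong (bottom-≈ y∈ refl) (≈-sym (↭⇒≈ (↭-sym p) commuting)) ∙ ≈-sym top)

  numBoolInt : NumBoolInt (2 + n) k N
  numBoolInt = (λ i → Item.interval (item i))
    , (λ i j e e′ → lookup-injective (labelled-unique n k) i j (distinct (item i) (item j) e e′))
    , λ { (_ , u≤w , B) → find (boolean⇒commuting u≤w B) }

theorem3p15 : (n k : ℕ) → 2 ≤ n →
    Σ ℕ λ N → NumBoolInt n k N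
      × (N * 2 ^ (k + 1)
         ≡ 2 ^ n * n ! * ( binomℤ (+ n - + k) (+ k - + 2)
                         + binomℤ (+ n - + k - + 1) (+ k - + 1)
                         + binomℤ (+ n - + k) (+ k)))
theorem3p15 (suc (suc n)) k (s≤s (s≤s z≤n)) = length (labelled n k) , numBoolInt n k , (begin
  N * 2 ^ (k + 1)                            ≡⟨ cong (N *_) (ℕₚ.^-distribˡ-+-* 2 k 1) ⟩
  N * (2 ^ k * 2)                            ≡⟨ ℕₚ.*-assoc N (2 ^ k) 2 ⟨
  N * 2 ^ k * 2                              ≡⟨ cong (_* 2) (length-labelled n k) ⟩
  length (independent n k) * length (points n) * 2
    ≡⟨ cong₂ (λ x y → x * y * 2) (length-independent n k) (Listₚ.length-map (decode (suc n)) (codes (suc n))) ⟩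
  count (2 + n) k * length (codes (suc n)) * 2   ≡⟨ ℕₚ.*-assoc (count (2 + n) k) (length (codes (suc n))) 2 ⟩
  count (2 + n) k * (length (codes (suc n)) * 2) ≡⟨ cong (count (2 + n) k *_) (length-codes (suc n)) ⟩
  count (2 + n) k * (2 ^ (2 + n) * (2 + n) !)    ≡⟨ ℕₚ.*-comm (count (2 + n) k) _ ⟩
  2 ^ (2 + n) * (2 + n) ! * count (2 + n) k      ∎)
  where
  open ≡-Reasoning
  N = length (labelled n k)
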